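{- Let $\mathcal{A}=(A;\theta)$ be a countable connected monounary algebra. Then the following are equivalent: (1) $\mathcal{A}$ is $\omega$-categorical; (2) $\mathrm{cyc}(\mathcal{A})$ is nonempty and $\mathcal{A}_c$ is $\omega$-categorical for each $c\in\mathrm{cyc}(\mathcal{A})$; (3) $\mathrm{cyc}(\mathcal{A})$ is nonempty and $(A_c;\leq)$ is $\omega$-categorical for each $c\in\mathrm{cyc}(\mathcal{A})$; (4) $\mathrm{ht}(\mathcal{A})\in\omega$ and $\{\mathcal{A}_x:x\in A\}$ is finite, up to isomorphism; (5) $\mathcal{A}$ is locally finite and has finitely many $1$-orbits.
   Context: A monounary algebra is a pair $\mathcal{A}=(A;\theta)$ where $A$ is a nonempty set and $\theta\colon A\to A$. It is connected if for all $x,y\in A$ there are $n,m\geq 0$ with $\theta^n(x)=\theta^m(y)$. It is locally finite if every finitely generated subalgebra (nonempty subset closed under $\theta$) is finite. $\mathbb{N}=\{1,2,\dots\}$, $\omega=\mathbb{N}\cup\{0\}$. An element $x$ is cyclic if $\theta^n(x)=x$ for some $n\in\mathbb{N}$; $\mathrm{cyc}(\mathcal{A})$ is the set of cyclic elements. $\mathrm{ht}(x)$ is the least $n\in\omega$ with $\theta^n(x)$ cyclic, or $\infty$ if there is none; $\mathrm{ht}(\mathcal{A})$ is the least $n\in\omega$ with $\mathrm{ht}(x)\leq n$ for all $x\in A$, or $\infty$ if there is none. For $z\in A$ let $$A_z=\{z\}\cup\{x\in A\setminus\mathrm{cyc}(\mathcal{A}):(\exists n\in\mathbb{N})\ \theta^n(x)=z,\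 \theta^{n-1}(x)\notin\mathrm{cyc}(\mathcal{A})\},$$ and let $\mathcal{A}_z$ be the partial monounary algebra on $A_z$ whose operation is $\theta$ restricted to $\{x\in A_z:\theta(x)\in A_z\}$. An isomorphism of partial monounary algebras $(B;\theta)\to(B';\theta')$ is a bijection $\phi$ with $x\in\mathrm{dom}(\theta)$ iff $\phi(x)\in\mathrm{dom}(\theta')$, and then $\phi(\theta(x))=\theta'(\phi(x))$; automorphisms are defined accordingly. For $c\in\mathrm{cyc}(\mathcal{A})$, $\leq$ is the partial order on $A_c$ given by $a\geq b$ iff $\theta^k(a)=b$ for some $k\in\omega$. A countable structure is $\omega$-categorical if every countable structure with the same first-order theory is isomorphic to it; equivalently (Ryll-Nardzewski), its automorphism group is oligomorphic, i.e. has only finitely many orbits on $n$-tuples for every $n\geq 1$. A (countable) partial monounary algebra is called $\omega$-categorical if its automorphism group is oligomorphic. The $1$-orbits of $\mathcal{A}$ are the orbits of $\mathrm{Aut}(\mathcal{A})$ on $A$. -}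

module Defs where

open import Data.Empty using (⊥)
open import Data.Fin.Base using (Fin)
open import Data.Irrelevant using ([_])
open import Data.List.Base using (List; _∷_)
open import Data.List.Membership.Propositional using (_∈_)
open import Data.List.Relation.Unary.Any using (Any)
open import Data.Nat.Base using (ℕ; zero; suc; _≤_)
open import Data.Nat.GeneralisedArithmetic using (fold)
open import Data.Product.Base using (Σ; Σ-syntax; ∃; ∃-syntax; ∃₂; _×_)
open import Data.Refinement.Base using (Refinement; Refinement-syntax; value; _,_)
open import Data.Sum.Base using (_⊎_)
open import Data.Vec.Base using (Vec; []; _∷_; lookup; map)
open import Function.Bundles using (_⇔_; _↣_; _⤖_; module Bijection)
open import Relation.Binary.PropositionalEquality.Core using (_≡_)
open import Relation.Nullary.Negation.Core using (¬_)

-- Finite or countably infinite.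
Countable : Set → Set
Countable X = X ↣ ℕ

FinitelyManyUpTo : {X : Set} → (X → X → Set) → Set
FinitelyManyUpTo {X} _~_ = Σ[ xs ∈ List X ] (∀ x → Any (x ~_) xs)

FiniteSubset : {X : Set} → (X → Set) → Set
FiniteSubset {X} S = Σ[ xs ∈ List X ] (∀ x → S x → x ∈ xs)

IsLeast : (ℕ → Set) → ℕ → Set
IsLeast P n = P n × (∀ m → P m → n ≤ m)

------------------------------------------------------------------------
-- First-order logic with equality

record Language : Set₁ where
  field
    Op  : ℕ → Set
    Rel : ℕ → Set

module _ (L : Language) where
  open Language L

  data Term (n : ℕ) : Set where
    var : Fin n → Term n
    app : ∀ {k} → Op k → Vec (Term n) k → Term n

  -- Formulas whose free variables are among n de Bruijn indices. The
  -- semantics is only used classically, where these connectives suffice.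
  data Formula (n : ℕ) : Set where
    falsum : Formula n
    _≐_    : Term n → Term n → Formula n
    rel    : ∀ {k} → Rel k → Vec (Term n) k → Formula n
    _⊃_    : Formula n → Formula n → Formula n
    all    : Formula (suc n) → Formula n

  Sentence : Set
  Sentence = Formula zero

  record Structure : Set₁ where
    field
      Carrier : Set
      opᴵ     : ∀ {k} → Op k → Vec Carrier k → Carrier
      relᴵ    : ∀ {k} → Rel k → Vec Carrier k → Set

module _ {L : Language} where
  open Language L
  open Structure

  module _ (M : Structure L) where

    mutual
      eval : ∀ {n} → Vec (Carrier M) n → Term L n → Carrier M
      eval ρ (var i)    = lookup ρ i
      eval ρ (app f ts) = opᴵ M f (evals ρ ts)

      evals : ∀ {n k} → Vec (Carrier M) n → Vec (Term L n) k → Vec (Carrier M) k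
      evals ρ []       = []
      evals ρ (t ∷ ts) = eval ρ t ∷ evals ρ ts

    Sat : ∀ {n} → Vec (Carrier M) n → Formula L n → Set
    Sat ρ falsum     = ⊥
    Sat ρ (s ≐ t)    = eval ρ s ≡ eval ρ t
    Sat ρ (rel r ts) = relᴵ M r (evals ρ ts)
    Sat ρ (φ ⊃ ψ)    = Sat ρ φ → Sat ρ ψ
    Sat ρ (all φ)    = ∀ a → Sat (a ∷ ρ) φ

  infix 4 _⊨_ _≡ₑ_ _≅_

  _⊨_ : Structure L → Sentence L → Set
  M ⊨ φ = Sat M [] φ

  _≡ₑ_ : Structure L → Structure L → Set
  M ≡ₑ N = ∀ φ → (M ⊨ φ) ⇔ (N ⊨ φ)

  record _≅_ (M N : Structure L) : Set where
    field
      bijection : Carrier M ⤖ Carrier N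
    open Bijection bijection public using (to)
    field
      preserves-op  : ∀ {k} (f : Op k) xs →
                      to (opᴵ M f xs) ≡ opᴵ N f (map to xs)
      preserves-rel : ∀ {k} (r : Rel k) xs →
                      relᴵ M r xs ⇔ relᴵ N r (map to xs)

  -- Only meant for countable M.
  ωCategorical : Structure L → Set₁
  ωCategorical M = ∀ (N : Structure L) → Countable (Carrier N) → N ≡ₑ M → N ≅ M

  SameOrbit : (M : Structure L) → Carrier M → Carrier M → Set
  SameOrbit M x y = Σ[ σ ∈ M ≅ M ] _≅_.to σ x ≡ y

------------------------------------------------------------------------
-- Partial monounary algebras

record PartialMonounaryAlgebra : Set₁ where
  field
    Carrier : Set
    Dom     : Carrier → Set
    θ       : ∀ x → .(Dom x) → Carrier

record _≅ᵖ_ (B B′ : PartialMonounaryAlgebra) : Set where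
  private
    module B  = PartialMonounaryAlgebra B
    module B′ = PartialMonounaryAlgebra B′
  field
    bijection : B.Carrier ⤖ B′.Carrier
  open Bijection bijection public using (to)
  field
    preserves-Dom : ∀ x → B.Dom x ⇔ B′.Dom (to x)
    preserves-θ   : ∀ x (d : B.Dom x) (d′ : B′.Dom (to x)) →
                    to (B.θ x d) ≡ B′.θ (to x) d′

infix 4 _≅ᵖ_

-- For partial algebras, ω-categoricity means by definition that the
-- automorphism group is oligomorphic.
ωCategoricalᵖ : PartialMonounaryAlgebra → Set
ωCategoricalᵖ B = ∀ n → 1 ≤ n → FinitelyManyUpTo (SameTupleOrbit {n})
  where
  open PartialMonounaryAlgebra B
  SameTupleOrbit : ∀ {n} → Vec Carrier n → Vec Carrier n → Set
  SameTupleOrbit xs ys = Σ[ σ ∈ B ≅ᵖ B ] map (_≅ᵖ_.to σ) xs ≡ ys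

------------------------------------------------------------------------
-- Monounary algebras

data UnaryOp : ℕ → Set where
  θ̇ : UnaryOp 1

data BinaryRel : ℕ → Set where
  ≤̇ : BinaryRel 2

monounaryLanguage : Language
monounaryLanguage = record { Op = UnaryOp ; Rel = λ _ → ⊥ }

orderLanguage : Language
orderLanguage = record { Op = λ _ → ⊥ ; Rel = BinaryRel }

record MonounaryAlgebra : Set₁ where
  field
    Carrier   : Set
    inhabited : Carrier
    θ         : Carrier → Carrier

  θ^ : ℕ → Carrier → Carrier
  θ^ n x = fold x θ n

  structure : Structure monounaryLanguage
  structure = record
    { Carrier = Carrier
    ; opᴵ     = λ { θ̇ (x ∷ []) → θ x }
    ; relᴵ    = λ ()
    }

  Connected : Set
  Connected = ∀ x y → ∃₂ λ n m → θ^ n x ≡ θ^ m y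

  data Generated (X : List Carrier) : Carrier → Set where
    gen  : ∀ {x} → x ∈ X → Generated X x
    step : ∀ {x} → Generated X x → Generated X (θ x)

  LocallyFinite : Set
  LocallyFinite = ∀ x xs → FiniteSubset (Generated (x ∷ xs))

  Cyclic : Carrier → Set
  Cyclic x = ∃[ n ] θ^ (suc n) x ≡ x

  IsHeightOf : Carrier → ℕ → Set
  IsHeightOf x = IsLeast (λ n → Cyclic (θ^ n x))

  -- ht(x) ≤ n; since n is finite, this excludes ht(x) = ∞.
  HeightOf_≤_ : Carrier → ℕ → Set
  HeightOf x ≤ n = ∃[ m ] IsHeightOf x m × m ≤ n

  IsHeight : ℕ → Set
  IsHeight = IsLeast (λ n → ∀ x → HeightOf x ≤ n)

  HasFiniteHeight : Set
  HasFiniteHeight = ∃ IsHeight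

  InTree : Carrier → Carrier → Set
  InTree z x = x ≡ z ⊎ (¬ Cyclic x × ∃[ n ] θ^ (suc n) x ≡ z × ¬ Cyclic (θ^ n x))

  -- The membership proof is irrelevant, so elements are equal as soon as
  -- their values are.
  Tree : Carrier → Set
  Tree z = [ x ∈ Carrier ∣ InTree z x ]

  partialAlgebra : Carrier → PartialMonounaryAlgebra
  partialAlgebra z = record
    { Carrier = Tree z
    ; Dom     = λ x → InTree z (θ (value x))
    ; θ       = λ x d → θ (value x) , [ d ]
    }

  -- b ≤ a holds when some iterate of θ takes a to b, so z is least.
  order : Carrier → Structure orderLanguage
  order z = record
    { Carrier = Tree z
    ; opᴵ     = λ ()
    ; relᴵ    = λ { ≤̇ (b ∷ a ∷ []) → ∃[ k ] θ^ k (value a) ≡ value b }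
    }

{-# OPTIONS --safe #-}
module Submission where

-- A countable structure M in a finite language is ω-categorical iff it is
-- oligomorphic. Indeed, if M is ω-categorical, then it realises every finitely
-- satisfiable set of formulas and omits every non-isolated type, because some
-- countable model of its theory does. So all types realised in M are isolated,
-- there are finitely many of them for each arity, and back and forth turns
-- equality of types into equality of orbits. The countable models are obtained
-- without compactness: conditions are finite sets of formulas about constants
-- that hold in M under some assignment, and a generic chain of conditions
-- generates a filter on the assignments, from which a model with Łoś's theorem
-- is read off.
--
-- To show that an algebra is oligomorphic, let T be a relation with finitely many classes
-- on it, where the height is bounded, such that the acyclic preimages of T-related
-- vertices embed into one another along T. Finite partial automorphisms that
-- preserve T and contain the cycle then extend by one vertex at a time, so they
-- extend to automorphisms, and a stabiliser of finitely many points has finitely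
-- many orbits on each level of the algebra: up to the stabiliser of a vertex z
-- and these points, only the T-class of a new preimage of z matters. In (3), (4)
-- and (5), T is read off the automorphisms of the orders, the isomorphisms of
-- the trees and the automorphisms of the algebra.

open import Defs
open import Axiom.ExcludedMiddle using (ExcludedMiddle)
open import Data.Empty using (⊥; ⊥-elim)
open import Data.Fin.Base as Fin using (Fin; zero; suc; toℕ; _↑ˡ_; _↑ʳ_)
import Data.Fin.Properties as Fin
open import Data.Irrelevant using ([_])
open import Data.List.Base as List using (List; []; _∷_; _++_; length)
import Data.List.Properties as List
open import Data.List.Membership.Propositional using (_∈_; _∉_; find; lose)
import Data.List.Membership.Propositional.Properties as ∈
open import Data.List.Relation.Unary.All as All using (All; []; _∷_)
import Data.List.Relation.Unary.All.Properties as All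
open import Data.List.Relation.Unary.Any as Any using (Any; here; there)
import Data.List.Relation.Unary.Any.Properties as Any
open import Data.Nat.Base using (ℕ; zero; suc; _+_; _*_; _⊔_; _∸_; _≤_; _<_; z≤n; s≤s)
open import Data.Nat.DivMod using (_mod_; m<n⇒m%n≡m)
open import Data.Nat.GeneralisedArithmetic using (fold-+)
open import Data.Nat.Induction using (<-wellFounded)
open import Data.Nat.Properties
open import Data.Product.Base using (Σ; Σ-syntax; ∃; ∃-syntax; ∃₂; _×_; _,_; proj₁; proj₂; uncurry)
open import Data.Refinement.Base using (value; _,_)
open import Data.Sum.Base using (_⊎_; inj₁; inj₂; [_,_]′)
open import Data.Unit.Base using (⊤; tt)
open import Data.Vec.Base as Vec using (Vec; []; _∷_; lookup)
import Data.Vec.Properties as Vec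
open import Data.Vec.Relation.Unary.All using ([]; _∷_) renaming (All to VAll)
open import Function.Base using (_∘_; id; case_of_)
open import Function.Bundles using (_⇔_; mk⇔; mk↣; _⤖_; mk⤖; module Equivalence; module Injection; module Bijection)
open import Induction.WellFounded using (Acc; acc)
open import Level using (0ℓ)
open import Relation.Binary.Construct.Closure.ReflexiveTransitive using (Star; ε; _◅_; _◅◅_; reverse)
open import Relation.Binary.PropositionalEquality
open import Relation.Nullary using (yes; no; ¬_; contradiction)
open import Relation.Nullary.Decidable using (decidable-stable; recompute)

-- First-order logic

module _ {L : Language} where

  infix 30 ¬̇_
  infixr 25 _∧̇_

  ¬̇_ : ∀ {n} → Formula L n → Formula L n
  ¬̇ φ = φ ⊃ falsum

  _∧̇_ : ∀ {n} → Formula L n → Formula L n → Formula L n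
  φ ∧̇ ψ = ¬̇ (φ ⊃ ¬̇ ψ)

  ∃̇ : ∀ {n} → Formula L (suc n) → Formula L n
  ∃̇ φ = ¬̇ all (¬̇ φ)

  ⋀ : ∀ {n} → List (Formula L n) → Formula L n
  ⋀ []       = falsum ⊃ falsum
  ⋀ (φ ∷ φs) = φ ∧̇ ⋀ φs

  ∃̇^ : ∀ k {n} → Formula L (k + n) → Formula L n
  ∃̇^ zero    φ = φ
  ∃̇^ (suc k) φ = ∃̇^ k (∃̇ φ)

  -- Universal closure, which turns a statement about all tuples into a sentence of the theory.
  close : ∀ n → Formula L n → Sentence L
  close zero    φ = φ
  close (suc n) φ = close n (all φ)

  mutual
    renameTerm : ∀ {m n} → (Fin m → Fin n) → Term L m → Term L n
    renameTerm f (var i)    = var (f i)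
    renameTerm f (app g ts) = app g (renameTerms f ts)

    renameTerms : ∀ {m n k} → (Fin m → Fin n) → Vec (Term L m) k → Vec (Term L n) k
    renameTerms f []       = []
    renameTerms f (t ∷ ts) = renameTerm f t ∷ renameTerms f ts

  rename : ∀ {m n} → (Fin m → Fin n) → Formula L m → Formula L n
  rename f falsum     = falsum
  rename f (s ≐ t)    = renameTerm f s ≐ renameTerm f t
  rename f (rel r ts) = rel r (renameTerms f ts)
  rename f (φ ⊃ ψ)    = rename f φ ⊃ rename f ψ
  rename f (all φ)    = all (rename (Fin.lift 1 f) φ)

  vars : ∀ {m n} → (Fin m → Fin n) → Vec (Term L n) m
  vars f = Vec.tabulate (var ∘ f)

  module _ (M : Structure L) where
    open Structure M

    evals-vars : ∀ {m n} (f : Fin m → Fin n) (ρ : Vec Carrier n) →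
                 evals M ρ (vars f) ≡ Vec.tabulate (lookup ρ ∘ f)
    evals-vars {zero}  f ρ = refl
    evals-vars {suc m} f ρ = cong (lookup ρ (f zero) ∷_) (evals-vars (f ∘ suc) ρ)

    module _ {m n} {f : Fin m → Fin n} {ρ : Vec Carrier m} {ρ′ : Vec Carrier n}
             (ρ≗ρ′ : ∀ i → lookup ρ i ≡ lookup ρ′ (f i)) where
      mutual
        eval-rename : ∀ t → eval M ρ t ≡ eval M ρ′ (renameTerm f t)
        eval-rename (var i)    = ρ≗ρ′ i
        eval-rename (app g ts) = cong (opᴵ g) (evals-rename ts)

        evals-rename : ∀ {k} (ts : Vec (Term L m) k) →
                       evals M ρ ts ≡ evals M ρ′ (renameTerms f ts)
        evals-rename []       = refl
        evals-rename (t ∷ ts) = cong₂ _∷_ (eval-rename t) (evals-rename ts)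

    sat-rename : ∀ {m n} {f : Fin m → Fin n} {ρ ρ′} → (∀ i → lookup ρ i ≡ lookup ρ′ (f i)) →
                 ∀ φ → Sat M ρ φ ⇔ Sat M ρ′ (rename f φ)
    sat-rename eq falsum     = mk⇔ id id
    sat-rename eq (s ≐ t)    = mk⇔
      (λ p → trans (sym (eval-rename eq s)) (trans p (eval-rename eq t)))
      (λ p → trans (eval-rename eq s) (trans p (sym (eval-rename eq t))))
    sat-rename eq (rel r ts) = mk⇔
      (subst (relᴵ r) (evals-rename eq ts)) (subst (relᴵ r) (sym (evals-rename eq ts)))
    sat-rename eq (φ ⊃ ψ)    = mk⇔
      (λ p q → Equivalence.to (sat-rename eq ψ) (p (Equivalence.from (sat-rename eq φ) q)))
      (λ p q → Equivalence.from (sat-rename eq ψ) (p (Equivalence.to (sat-rename eq φ) q)))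
    sat-rename {f = f} {ρ} {ρ′} eq (all φ) = mk⇔
      (λ p a → Equivalence.to (sat-rename (eq′ a) φ) (p a))
      (λ p a → Equivalence.from (sat-rename (eq′ a) φ) (p a))
      where
      eq′ : ∀ a i → lookup (a ∷ ρ) i ≡ lookup (a ∷ ρ′) (Fin.lift 1 f i)
      eq′ a zero    = refl
      eq′ a (suc i) = eq i

    sat-close : ∀ n φ → M ⊨ close n φ ⇔ (∀ ρ → Sat M ρ φ)
    sat-close zero    φ = mk⇔ (λ { p [] → p }) (λ p → p [])
    sat-close (suc n) φ = mk⇔
      (λ { p (a ∷ ρ) → Equivalence.to (sat-close n (all φ)) p ρ a })
      (λ p → Equivalence.from (sat-close n (all φ)) (λ ρ a → p (a ∷ ρ)))

  module _ {M N : Structure L} (σ : M ≅ N) where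
    private
      module M = Structure M
      module N = Structure N
    open _≅_ σ

    mutual
      eval-≅ : ∀ {n} (ρ : Vec M.Carrier n) t → to (eval M ρ t) ≡ eval N (Vec.map to ρ) t
      eval-≅ ρ (var i)    = sym (Vec.lookup-map i to ρ)
      eval-≅ ρ (app f ts) = trans (preserves-op f _) (cong (N.opᴵ f) (evals-≅ ρ ts))

      evals-≅ : ∀ {n k} (ρ : Vec M.Carrier n) (ts : Vec (Term L n) k) →
                Vec.map to (evals M ρ ts) ≡ evals N (Vec.map to ρ) ts
      evals-≅ ρ []       = refl
      evals-≅ ρ (t ∷ ts) = cong₂ _∷_ (eval-≅ ρ t) (evals-≅ ρ ts)

    to-injective : ∀ {x y} → to x ≡ to y → x ≡ y
    to-injective = Bijection.injective bijection

    to⁻¹ : N.Carrier → M.Carrier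
    to⁻¹ y = proj₁ (Bijection.surjective bijection y)

    to∘to⁻¹ : ∀ y → to (to⁻¹ y) ≡ y
    to∘to⁻¹ y = proj₂ (Bijection.surjective bijection y) refl

    to⁻¹∘to : ∀ x → to⁻¹ (to x) ≡ x
    to⁻¹∘to x = to-injective (to∘to⁻¹ (to x))

    sat-≅ : ∀ {n} (ρ : Vec M.Carrier n) φ → Sat M ρ φ ⇔ Sat N (Vec.map to ρ) φ
    sat-≅ ρ falsum     = mk⇔ id id
    sat-≅ ρ (s ≐ t)    = mk⇔
      (λ p → trans (sym (eval-≅ ρ s)) (trans (cong to p) (eval-≅ ρ t)))
      (λ p → to-injective (trans (eval-≅ ρ s) (trans p (sym (eval-≅ ρ t)))))
    sat-≅ ρ (rel r ts) = mk⇔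
      (λ p → subst (N.relᴵ r) (evals-≅ ρ ts) (Equivalence.to (preserves-rel r _) p))
      (λ p → Equivalence.from (preserves-rel r _) (subst (N.relᴵ r) (sym (evals-≅ ρ ts)) p))
    sat-≅ ρ (φ ⊃ ψ)    = mk⇔
      (λ p q → Equivalence.to (sat-≅ ρ ψ) (p (Equivalence.from (sat-≅ ρ φ) q)))
      (λ p q → Equivalence.from (sat-≅ ρ ψ) (p (Equivalence.to (sat-≅ ρ φ) q)))
    sat-≅ ρ (all φ)    = mk⇔
      (λ p b → subst (λ b → Sat N (b ∷ Vec.map to ρ) φ) (to∘to⁻¹ b)
                 (Equivalence.to (sat-≅ (to⁻¹ b ∷ ρ) φ) (p (to⁻¹ b))))
      (λ p a → Equivalence.from (sat-≅ (a ∷ ρ) φ) (p (to a)))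

  ≅-refl : ∀ {M : Structure L} → M ≅ M
  ≅-refl {M} = record
    { bijection     = mk⤖ (id , λ y → y , id)
    ; preserves-op  = λ f xs → cong (Structure.opᴵ M f) (sym (Vec.map-id xs))
    ; preserves-rel = λ r xs → mk⇔ (subst (Structure.relᴵ M r) (sym (Vec.map-id xs)))
                                   (subst (Structure.relᴵ M r) (Vec.map-id xs))
    }

  ≅-sym : ∀ {M N : Structure L} → M ≅ N → N ≅ M
  ≅-sym {M} {N} σ = record
    { bijection     = mk⤖ ((λ eq → trans (sym (to∘to⁻¹ σ _)) (trans (cong to eq) (to∘to⁻¹ σ _))) ,
                           (λ x → to x , λ { refl → to⁻¹∘to σ x }))
    ; preserves-op  = λ f ys → to-injective σ (begin
        to (to⁻¹ σ (N.opᴵ f ys))                  ≡⟨ to∘to⁻¹ σ _ ⟩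
        N.opᴵ f ys                                ≡⟨ cong (N.opᴵ f) (map-to∘to⁻¹ ys) ⟨
        N.opᴵ f (Vec.map to (Vec.map (to⁻¹ σ) ys)) ≡⟨ preserves-op f _ ⟨
        to (M.opᴵ f (Vec.map (to⁻¹ σ) ys))        ∎)
    ; preserves-rel = λ r ys → mk⇔
        (λ h → Equivalence.from (preserves-rel r _) (subst (N.relᴵ r) (sym (map-to∘to⁻¹ ys)) h))
        (λ h → subst (N.relᴵ r) (map-to∘to⁻¹ ys) (Equivalence.to (preserves-rel r _) h))
    }
    where
    module M = Structure M
    module N = Structure N
    open _≅_ σ
    open ≡-Reasoning

    map-to∘to⁻¹ : ∀ {k} (ys : Vec N.Carrier k) → Vec.map to (Vec.map (to⁻¹ σ) ys) ≡ ys
    map-to∘to⁻¹ ys = trans (sym (Vec.map-∘ to (to⁻¹ σ) ys))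
      (trans (Vec.map-cong (to∘to⁻¹ σ) ys) (Vec.map-id ys))

  ≅-trans : ∀ {M N O : Structure L} → M ≅ N → N ≅ O → M ≅ O
  ≅-trans {M} {N} {O} σ τ = record
    { bijection     = mk⤖ ((λ eq → to-injective σ (to-injective τ eq)) ,
        λ z → to⁻¹ σ (to⁻¹ τ z) , λ { refl → trans (cong τ.to (to∘to⁻¹ σ _)) (to∘to⁻¹ τ z) })
    ; preserves-op  = λ f xs → trans (cong τ.to (σ.preserves-op f xs))
        (trans (τ.preserves-op f _) (cong (Structure.opᴵ O f) (sym (Vec.map-∘ τ.to σ.to xs))))
    ; preserves-rel = λ r xs → mk⇔
        (λ h → subst (Structure.relᴵ O r) (sym (Vec.map-∘ τ.to σ.to xs))
                 (Equivalence.to (τ.preserves-rel r _) (Equivalence.to (σ.preserves-rel r xs) h)))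
        (λ h → Equivalence.from (σ.preserves-rel r xs) (Equivalence.from (τ.preserves-rel r _)
                 (subst (Structure.relᴵ O r) (Vec.map-∘ τ.to σ.to xs) h)))
    }
    where
    module σ = _≅_ σ
    module τ = _≅_ τ

  SameType : ∀ (M N : Structure L) {n} →
             Vec (Structure.Carrier M) n → Vec (Structure.Carrier N) n → Set
  SameType M N ρ ρ′ = ∀ φ → Sat M ρ φ → Sat N ρ′ φ

  SameTupleOrbit : ∀ (M : Structure L) {n} →
                   Vec (Structure.Carrier M) n → Vec (Structure.Carrier M) n → Set
  SameTupleOrbit M ρ ρ′ = Σ[ σ ∈ M ≅ M ] Vec.map (_≅_.to σ) ρ ≡ ρ′

  orbit-refl : ∀ {M : Structure L} {n} {ρ : Vec (Structure.Carrier M) n} → SameTupleOrbit M ρ ρ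
  orbit-refl {ρ = ρ} = ≅-refl , Vec.map-id ρ

  orbit-sym : ∀ {M : Structure L} {n} {ρ ρ′ : Vec (Structure.Carrier M) n} →
              SameTupleOrbit M ρ ρ′ → SameTupleOrbit M ρ′ ρ
  orbit-sym {ρ = ρ} (σ , refl) = ≅-sym σ ,
    trans (sym (Vec.map-∘ _ _ ρ)) (trans (Vec.map-cong (to⁻¹∘to σ) ρ) (Vec.map-id ρ))

  orbit-trans : ∀ {M : Structure L} {n} {ρ ρ′ ρ″ : Vec (Structure.Carrier M) n} →
                SameTupleOrbit M ρ ρ′ → SameTupleOrbit M ρ′ ρ″ → SameTupleOrbit M ρ ρ″
  orbit-trans {ρ = ρ} (σ , refl) (τ , refl) = ≅-trans σ τ , Vec.map-∘ (_≅_.to τ) (_≅_.to σ) ρ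

  SameTupleOrbit⇒SameType : ∀ (M : Structure L) {n} {ρ ρ′ : Vec (Structure.Carrier M) n} →
                            SameTupleOrbit M ρ ρ′ → SameType M M ρ ρ′
  SameTupleOrbit⇒SameType M {ρ = ρ} (σ , refl) φ = Equivalence.to (sat-≅ σ ρ φ)

-- Enumerations of terms and formulas

-- The enumerations below proceed by finite stages. Holding from some stage on lets finitely many
-- ingredients be found at one common stage.
Eventually : (ℕ → Set) → Set
Eventually P = ∃[ k ] (∀ j → k ≤ j → P j)

eventually-suc : ∀ {P : ℕ → Set} → Eventually (P ∘ suc) → Eventually P
eventually-suc (k , p) = suc k , λ { (suc j) (s≤s k≤j) → p j k≤j }

always : ∀ {P : ℕ → Set} → (∀ j → P j) → Eventually P
always p = 0 , λ j _ → p j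

infixr 4 _⊗_
_⊗_ : ∀ {P Q : ℕ → Set} → Eventually P → Eventually Q → Eventually (λ j → P j × Q j)
(k , p) ⊗ (l , q) = k ⊔ l , λ j k⊔l≤j →
  p j (≤-trans (m≤m⊔n k l) k⊔l≤j) , q j (≤-trans (m≤n⊔m k l) k⊔l≤j)

eventually-map : ∀ {P Q : ℕ → Set} → (∀ {j} → P j → Q j) → Eventually P → Eventually Q
eventually-map f (k , p) = k , λ j k≤j → f (p j k≤j)

eventually-All : {X : Set} {P : X → ℕ → Set} → (∀ x → Eventually (P x)) →
                 ∀ xs → Eventually (λ j → All (λ x → P x j) xs)
eventually-All ev []       = always (λ _ → [])
eventually-All ev (x ∷ xs) = eventually-map (uncurry _∷_) (ev x ⊗ eventually-All ev xs)

vectors : {X : Set} → List X → ∀ n → List (Vec X n)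
vectors xs zero    = [] ∷ []
vectors xs (suc n) = List.cartesianProductWith _∷_ xs (vectors xs n)

∈-vectors : {X : Set} {xs : List X} {n : ℕ} {v : Vec X n} → VAll (_∈ xs) v → v ∈ vectors xs n
∈-vectors []       = here refl
∈-vectors (p ∷ ps) = ∈.∈-cartesianProductWith⁺ _∷_ p (∈-vectors ps)

∈-naturals : ∀ {n} (v : Vec ℕ n) → Eventually (λ j → VAll (_∈ List.upTo j) v)
∈-naturals []      = always (λ _ → [])
∈-naturals (m ∷ v) =
  eventually-map (uncurry _∷_) ((suc m , λ j → ∈.∈-upTo⁺) ⊗ ∈-naturals v)

record FiniteLanguage (L : Language) : Set where
  open Language L
  field
    ops  : List (∃ Op)
    rels : List (∃ Rel)
    ∈ops  : ∀ {k} (f : Op k) → (k , f) ∈ ops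
    ∈rels : ∀ {k} (r : Rel k) → (k , r) ∈ rels

module Enumeration {L : Language} (fin : FiniteLanguage L) where
  open FiniteLanguage fin

  terms : ℕ → ∀ n → List (Term L n)
  terms zero    n = []
  terms (suc j) n = List.map var (List.allFin n) ++
    List.concatMap (λ (k , f) → List.map (app f) (vectors (terms j n) k)) ops

  mutual
    ∈-terms : ∀ {n} (t : Term L n) → Eventually (λ j → t ∈ terms j n)
    ∈-terms {n} (var i) = eventually-suc (always λ j →
      ∈.∈-++⁺ˡ (∈.∈-map⁺ var (∈.∈-allFin i)))
    ∈-terms {n} (app f ts) = eventually-suc (eventually-map
      (λ ts∈ → ∈.∈-++⁺ʳ (List.map var (List.allFin n))
        (∈.∈-concatMap⁺ _ (lose (∈ops f) (∈.∈-map⁺ (app f) (∈-vectors ts∈)))))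
      (∈-termVectors ts))

    ∈-termVectors : ∀ {n k} (ts : Vec (Term L n) k) →
                    Eventually (λ j → VAll (_∈ terms j n) ts)
    ∈-termVectors []       = always (λ _ → [])
    ∈-termVectors (t ∷ ts) = eventually-map (uncurry _∷_) (∈-terms t ⊗ ∈-termVectors ts)

  atoms : ℕ → ∀ n → List (Formula L n)
  atoms j n = falsum ∷ List.cartesianProductWith _≐_ (terms j n) (terms j n) ++
    List.concatMap (λ (k , r) → List.map (rel r) (vectors (terms j n) k)) rels

  formulas : ℕ → ∀ n → List (Formula L n)
  formulas zero    n = []
  formulas (suc j) n = atoms j n ++
    (List.cartesianProductWith _⊃_ (formulas j n) (formulas j n) ++
     List.map all (formulas j (suc n)))

  ∈-formulas : ∀ {n} (φ : Formula L n) → Eventually (λ j → φ ∈ formulas j n)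
  ∈-formulas falsum     = eventually-suc (always λ j → here refl)
  ∈-formulas (s ≐ t)    = eventually-suc (eventually-map
    (λ (s∈ , t∈) → ∈.∈-++⁺ˡ (there (∈.∈-++⁺ˡ (∈.∈-cartesianProductWith⁺ _≐_ s∈ t∈))))
    (∈-terms s ⊗ ∈-terms t))
  ∈-formulas {n} (rel r ts) = eventually-suc (eventually-map
    (λ {j} ts∈ → ∈.∈-++⁺ˡ (there (∈.∈-++⁺ʳ (List.cartesianProductWith _≐_ (terms j n) (terms j n))
      (∈.∈-concatMap⁺ _ (lose (∈rels r) (∈.∈-map⁺ (rel r) (∈-vectors ts∈)))))))
    (∈-termVectors ts))
  ∈-formulas {n} (φ ⊃ ψ) = eventually-suc (eventually-map
    (λ {j} (φ∈ , ψ∈) → ∈.∈-++⁺ʳ (atoms j n)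
      (∈.∈-++⁺ˡ (∈.∈-cartesianProductWith⁺ _⊃_ φ∈ ψ∈)))
    (∈-formulas φ ⊗ ∈-formulas ψ))
  ∈-formulas {n} (all φ) = eventually-suc (eventually-map
    (λ {j} φ∈ → ∈.∈-++⁺ʳ (atoms j n)
      (∈.∈-++⁺ʳ (List.cartesianProductWith _⊃_ (formulas j n) (formulas j n))
        (∈.∈-map⁺ all φ∈)))
    (∈-formulas φ))

  -- The last `k` variables are filled with the constants numbered by the vector, and the first `δ`
  -- variables stay free: none for a statement, one for the body of a quantifier.
  Instance : ℕ → Set
  Instance δ = ∃[ k ] Formula L (δ + k) × Vec ℕ k

  instances : ∀ δ → ℕ → List (Instance δ)
  instances δ j = List.concatMap
    (λ k → List.cartesianProductWith (λ φ e → k , φ , e) (formulas j (δ + k)) (vectors (List.upTo j) k))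
    (List.upTo j)

  ∈-instances : ∀ δ χ → Eventually (λ j → χ ∈ instances δ j)
  ∈-instances δ (k , φ , e) = eventually-map
    (λ (k∈ , φ∈ , e∈) → ∈.∈-concatMap⁺ _ (lose (∈.∈-upTo⁺ k∈)
      (∈.∈-cartesianProductWith⁺ _ φ∈ (∈-vectors e∈))))
    ((suc k , λ _ → id) ⊗ ∈-formulas φ ⊗ ∈-naturals e)

-- Classical logic

module Classical (em : ExcludedMiddle 0ℓ) where

  stable : {P : Set} → ¬ ¬ P → P
  stable = decidable-stable em

  ¬∀⇒∃¬ : {X : Set} {P : X → Set} → ¬ (∀ x → P x) → ∃[ x ] ¬ P x
  ¬∀⇒∃¬ ¬p = stable (λ ¬∃ → ¬p (λ x → stable (λ ¬px → ¬∃ (x , ¬px))))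

  opaque
    least : {P : ℕ → Set} → ∃ P → ∃ (IsLeast P)
    least {P} (n , p) = go n p (<-wellFounded n)
      where
      go : ∀ n → P n → Acc _<_ n → ∃ (IsLeast P)
      go n p (acc rs) with em {∃[ m ] m < n × P m}
      ... | yes (m , m<n , q) = go m q (rs m<n)
      ... | no ∄              = n , p , λ m q → ≮⇒≥ (λ m<n → ∄ (m , m<n , q))

  module _ {L : Language} (M : Structure L) where
    open Structure M

    sat-∧ : ∀ {n} {ρ : Vec Carrier n} φ ψ → Sat M ρ (φ ∧̇ ψ) ⇔ (Sat M ρ φ × Sat M ρ ψ)
    sat-∧ φ ψ = mk⇔
      (λ h → stable (λ ¬p → h (λ p _ → ¬p p)) , stable (λ ¬q → h (λ _ q → ¬q q)))
      (λ (p , q) h → h p q)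

    sat-∃ : ∀ {n} {ρ : Vec Carrier n} φ → Sat M ρ (∃̇ φ) ⇔ (∃[ a ] Sat M (a ∷ ρ) φ)
    sat-∃ φ = mk⇔
      (λ h → case ¬∀⇒∃¬ h of λ (a , p) → a , stable p)
      (λ (a , p) h → h a p)

    sat-⋀ : ∀ {n} {ρ : Vec Carrier n} φs → Sat M ρ (⋀ φs) ⇔ All (Sat M ρ) φs
    sat-⋀ []       = mk⇔ (λ _ → []) (λ _ → id)
    sat-⋀ (φ ∷ φs) = mk⇔
      (λ h → case Equivalence.to (sat-∧ φ (⋀ φs)) h of λ
        (p , ps) → p ∷ Equivalence.to (sat-⋀ φs) ps)
      (λ { (p ∷ ps) → Equivalence.from (sat-∧ φ (⋀ φs)) (p , Equivalence.from (sat-⋀ φs) ps) })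

    sat-∃^ : ∀ k {n} {ρ : Vec Carrier n} φ →
             Sat M ρ (∃̇^ k φ) ⇔ (Σ[ v ∈ Vec Carrier k ] Sat M (v Vec.++ ρ) φ)
    sat-∃^ zero    φ = mk⇔ (λ p → [] , p) (λ { ([] , p) → p })
    sat-∃^ (suc k) φ = mk⇔
      (λ h → case Equivalence.to (sat-∃^ k (∃̇ φ)) h of λ (v , h′) →
        case Equivalence.to (sat-∃ φ) h′ of λ (a , p) → a ∷ v , p)
      (λ { (a ∷ v , p) →
        Equivalence.from (sat-∃^ k (∃̇ φ)) (v , Equivalence.from (sat-∃ φ) (a , p)) })

  -- Henkin's construction

  bounded : ∀ {k} (e : Vec ℕ k) → Eventually (λ m → VAll (_< m) e)
  bounded []      = always (λ _ → [])
  bounded (i ∷ e) = eventually-map (uncurry _∷_) ((suc i , λ _ → id) ⊗ bounded e)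

  iota : ∀ n → Vec ℕ n
  iota zero    = []
  iota (suc n) = 0 ∷ Vec.map suc (iota n)

  _[_≔_] : {X : Set} → (ℕ → X) → ℕ → X → ℕ → X
  (s [ m ≔ a ]) i with i ≟ m
  ... | yes _ = a
  ... | no  _ = s i

  ≔-same : {X : Set} (s : ℕ → X) (m : ℕ) (a : X) → (s [ m ≔ a ]) m ≡ a
  ≔-same s m a with m ≟ m
  ... | yes _  = refl
  ... | no m≢m = contradiction refl m≢m

  ≔-fresh : {X : Set} (s : ℕ → X) (m : ℕ) (a : X) → ∀ {k} {e : Vec ℕ k} → VAll (_< m) e →
            Vec.map (s [ m ≔ a ]) e ≡ Vec.map s e
  ≔-fresh s m a []                     = refl
  ≔-fresh s m a (_∷_ {x = i} i<m e<m) with i ≟ m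
  ... | yes i≡m = contradiction i≡m (<⇒≢ i<m)
  ... | no  _   = cong (s i ∷_) (≔-fresh s m a e<m)

  -- An ultrafilter as far as definable sets are concerned. `F-decides` is maximality, and
  -- `F-witness` makes a coordinate of the assignments the counterexample to a universal formula
  -- that fails, as Łoś's theorem requires when the elements are only the coordinates.
  record GenericFilter {L : Language} (M : Structure L) : Set₁ where
    open Structure M
    field
      F         : ((ℕ → Carrier) → Set) → Set
      F-pure    : ∀ {P} → (∀ s → P s) → F P
      F-zip     : ∀ {P Q R} → (∀ {s} → P s → Q s → R s) → F P → F Q → F R
      F-proper  : ∀ {P} → F P → ∃ P
      F-decides : ∀ {k} φ (e : Vec ℕ k) →
                  F (λ s → Sat M (Vec.map s e) φ) ⊎ F (λ s → ¬ Sat M (Vec.map s e) φ)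
      F-witness : ∀ {k} φ (e : Vec ℕ k) → F (λ s → Sat M (Vec.map s e) (all φ)) ⊎
                  (∃[ m ] F (λ s → ¬ Sat M (s m ∷ Vec.map s e) φ))

    F-map : ∀ {P Q} → (∀ {s} → P s → Q s) → F P → F Q
    F-map f p = F-zip (λ p _ → f p) p p

  -- The elements of the limit are the coordinates s ↦ s m, identified when equal on a set in F.
  module Limit {L : Language} {M : Structure L} (𝓕 : GenericFilter M) where
    open Structure M
    open GenericFilter 𝓕

    infix 4 _~_
    _~_ : ℕ → ℕ → Set
    m ~ k = F (λ s → s m ≡ s k)

    ~-sym : ∀ {m k} → m ~ k → k ~ m
    ~-sym = F-map sym

    ~-trans : ∀ {l m k} → l ~ m → m ~ k → l ~ k
    ~-trans = F-zip trans

    -- Each class is represented by its least number, so the quotient becomes a subset of the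
    -- natural numbers and is countable at once.
    canonical : ∀ m → ∃ (IsLeast (_~ m))
    canonical m = least (m , F-pure (λ _ → refl))

    rep : ℕ → ℕ
    rep m = proj₁ (canonical m)

    rep-~ : ∀ m → rep m ~ m
    rep-~ m = proj₁ (proj₂ (canonical m))

    rep-cong : ∀ {m k} → m ~ k → rep m ≡ rep k
    rep-cong {m} {k} m~k = ≤-antisym
      (proj₂ (proj₂ (canonical m)) _ (~-trans (rep-~ k) (~-sym m~k)))
      (proj₂ (proj₂ (canonical k)) _ (~-trans (rep-~ m) m~k))

    Element : Set
    Element = ∃[ m ] rep m ≡ m

    element : ℕ → Element
    element m = rep m , rep-cong (rep-~ m)

    element-≡ : {a b : Element} → proj₁ a ≡ proj₁ b → a ≡ b
    element-≡ {_ , p} {_ , q} refl = cong (_ ,_) (≡-irrelevant p q)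

    element-proj₁ : ∀ a → element (proj₁ a) ≡ a
    element-proj₁ (m , eq) = element-≡ eq

    elements-proj₁ : ∀ {k} (as : Vec Element k) → Vec.map element (Vec.map proj₁ as) ≡ as
    elements-proj₁ []       = refl
    elements-proj₁ (a ∷ as) = cong₂ _∷_ (element-proj₁ a) (elements-proj₁ as)

    evals-suc : ∀ {k a} (ρ : Vec Carrier k) → evals M (a ∷ ρ) (vars suc) ≡ ρ
    evals-suc {a = a} ρ = trans (evals-vars M suc (a ∷ ρ)) (Vec.tabulate∘lookup ρ)

    opaque
      -- The formula that every element differs from `f` of the constants is false, so the
      -- counterexample supplied by `F-witness` is a coordinate that names the value.
      op-witness : ∀ {k} (f : Language.Op L k) (e : Vec ℕ k) →
                   ∃[ m ] F (λ s → s m ≡ opᴵ f (Vec.map s e))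
      op-witness {k} f e with F-witness (¬̇ (app f (vars suc) ≐ var zero)) e
      ... | inj₁ ¬f      = case F-proper ¬f of λ (s , h) →
        contradiction (cong (opᴵ f) (evals-suc (Vec.map s e))) (h (opᴵ f (Vec.map s e)))
      ... | inj₂ (m , h) = m , F-map (λ {s} ¬¬eq →
        trans (sym (stable ¬¬eq)) (cong (opᴵ f) (evals-suc (Vec.map s e)))) h

    model : Structure L
    model = record
      { Carrier = Element
      ; opᴵ     = λ f as → element (proj₁ (op-witness f (Vec.map proj₁ as)))
      ; relᴵ    = λ r as → F (λ s → relᴵ r (Vec.map s (Vec.map proj₁ as)))
      }

    model-countable : Countable Element
    model-countable = mk↣ {to = proj₁} element-≡

    mutual
      -- Induction on terms. Each passage to a representative and each choice of an `op-witness` is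
      -- correct on a set in `F`, and finitely many such sets are intersected.
      F-eval : ∀ {k} (e : Vec ℕ k) t →
               F (λ s → s (proj₁ (eval model (Vec.map element e) t)) ≡ eval M (Vec.map s e) t)
      F-eval e (var i) rewrite Vec.lookup-map i element e =
        F-map (λ {s} eq → trans eq (sym (Vec.lookup-map i s e))) (rep-~ (lookup e i))
      F-eval e (app f ts) = F-zip (λ eq eqs → trans eq (cong (opᴵ f) eqs))
        (F-zip trans (rep-~ _) (proj₂ (op-witness f _))) (F-evals e ts)

      F-evals : ∀ {k l} (e : Vec ℕ k) (ts : Vec (Term L k) l) →
                F (λ s → Vec.map s (Vec.map proj₁ (evals model (Vec.map element e) ts)) ≡
                         evals M (Vec.map s e) ts)
      F-evals e []       = F-pure (λ _ → refl)
      F-evals e (t ∷ ts) = F-zip (cong₂ _∷_) (F-eval e t) (F-evals e ts)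

    -- Łoś's theorem by induction on the formula. `F-decides` serves the implication, and
    -- `F-witness` the quantifier, which in the model ranges over the coordinates only.
    truth : ∀ {k} φ (e : Vec ℕ k) →
            Sat model (Vec.map element e) φ ⇔ F (λ s → Sat M (Vec.map s e) φ)
    truth falsum e = mk⇔ ⊥-elim (λ f → proj₂ (F-proper f))
    truth (t ≐ u) e = mk⇔
      (λ eq → F-zip trans
        (F-map sym (subst (λ a → F (λ s → s (proj₁ a) ≡ _)) eq (F-eval e t))) (F-eval e u))
      (λ f → element-≡ (begin
        proj₁ (eval model (Vec.map element e) t)        ≡⟨ proj₂ (eval model (Vec.map element e) t) ⟨
        rep (proj₁ (eval model (Vec.map element e) t))  ≡⟨ rep-cong (F-zip trans
          (F-zip trans (F-eval e t) f) (F-map sym (F-eval e u))) ⟩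
        rep (proj₁ (eval model (Vec.map element e) u))  ≡⟨ proj₂ (eval model (Vec.map element e) u) ⟩
        proj₁ (eval model (Vec.map element e) u)        ∎))
      where open ≡-Reasoning
    truth (rel r ts) e = mk⇔
      (F-zip (λ eqs → subst (relᴵ r) eqs) (F-evals e ts))
      (F-zip (λ eqs → subst (relᴵ r) (sym eqs)) (F-evals e ts))
    truth {k} (φ ⊃ ψ) e = mk⇔ to from
      where
      to : Sat model (Vec.map element e) (φ ⊃ ψ) → F (λ s → Sat M (Vec.map s e) (φ ⊃ ψ))
      to h with F-decides φ e
      ... | inj₁ f  = F-map (λ sψ _ → sψ) (Equivalence.to (truth ψ e) (h (Equivalence.from (truth φ e) f)))
      ... | inj₂ ¬f = F-map (λ ¬sφ sφ → contradiction sφ ¬sφ) ¬f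

      from : F (λ s → Sat M (Vec.map s e) (φ ⊃ ψ)) → Sat model (Vec.map element e) (φ ⊃ ψ)
      from f h = Equivalence.from (truth ψ e) (F-zip (λ g → g) f (Equivalence.to (truth φ e) h))
    truth {k} (all φ) e = mk⇔ to from
      where
      to : Sat model (Vec.map element e) (all φ) → F (λ s → Sat M (Vec.map s e) (all φ))
      to h with F-witness φ e
      ... | inj₁ f        = f
      ... | inj₂ (m , ¬f) = ⊥-elim (proj₂ (F-proper (F-zip {R = λ _ → ⊥} (λ ¬sφ sφ → ¬sφ sφ) ¬f
                              (Equivalence.to (truth φ (m ∷ e)) (h (element m))))))

      from : F (λ s → Sat M (Vec.map s e) (all φ)) → Sat model (Vec.map element e) (all φ)
      from f a = subst (λ a → Sat model (a ∷ Vec.map element e) φ) (element-proj₁ a)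
        (Equivalence.from (truth φ (proj₁ a ∷ e)) (F-map (λ {s} h → h (s (proj₁ a))) f))

    model-≡ₑ : model ≡ₑ M
    model-≡ₑ φ = mk⇔
      (λ h → proj₂ (F-proper (Equivalence.to (truth φ []) h)))
      (λ h → Equivalence.from (truth φ []) (F-pure (λ _ → h)))

  module Henkin {L : Language} (fin : FiniteLanguage L) (M : Structure L)
                (point : Structure.Carrier M) {n : ℕ} (p : Formula L n → Set) where
    open Structure M
    open Enumeration fin

    Assignment : Set
    Assignment = ℕ → Carrier

    -- The pair (φ , e) stands for φ with the constants numbered by e as arguments.
    Condition : Set
    Condition = List (Instance 0)

    infix 4 _⊩_
    _⊩_ : Assignment → Instance 0 → Set
    s ⊩ (k , φ , e) = Sat M (Vec.map s e) φ

    -- The first n constants are meant to realise p.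
    Positive : Condition → Set
    Positive Γ = ∀ Δ → All p Δ → ∃[ s ] All (s ⊩_) Γ × All (Sat M (Vec.map s (iota n))) Δ

    bounded* : (Γ : Condition) → Eventually (λ m → All (λ (k , φ , e) → VAll (_< m) e) Γ)
    bounded* = eventually-All (λ (k , φ , e) → bounded e)

    assignment : ∀ {m} → Vec Carrier m → Assignment
    assignment []      _       = point
    assignment (a ∷ ρ) zero    = a
    assignment (a ∷ ρ) (suc i) = assignment ρ i

    assignment-iota : ∀ {m} (ρ : Vec Carrier m) → Vec.map (assignment ρ) (iota m) ≡ ρ
    assignment-iota []      = refl
    assignment-iota (a ∷ ρ) =
      cong (a ∷_) (trans (sym (Vec.map-∘ (assignment (a ∷ ρ)) suc (iota _))) (assignment-iota ρ))

    positive-[] : (∀ Δ → All p Δ → ∃[ ρ ] All (Sat M ρ) Δ) → Positive []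
    positive-[] finsat Δ pΔ with finsat Δ pΔ
    ... | ρ , sat = assignment ρ , [] , subst (λ ρ → All (Sat M ρ) Δ) (sym (assignment-iota ρ)) sat

    -- If `φ` cannot be added, some finite part `Δ₁` of `p` excludes it. Any assignment for `Γ` that
    -- satisfies `Δ₁` along with the given `Δ` then makes `φ` false.
    positive-¬ : ∀ {Γ} k φ e → Positive Γ → ¬ Positive ((k , φ , e) ∷ Γ) →
                 Positive ((k , ¬̇ φ , e) ∷ Γ)
    positive-¬ k φ e pos ¬pos Δ pΔ with ¬∀⇒∃¬ ¬pos
    ... | Δ₁ , ¬pos₁ with ¬∀⇒∃¬ ¬pos₁
    ... | pΔ₁ , ∄ with pos (Δ₁ ++ Δ) (All.++⁺ pΔ₁ pΔ)
    ... | s , sΓ , sΔ =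
      s , (λ sφ → ∄ (s , sφ ∷ sΓ , All.++⁻ˡ Δ₁ sΔ)) ∷ sΓ , All.++⁻ʳ Δ₁ sΔ

    -- The constant `m` lies beyond all constants in sight, so it can be reassigned to a
    -- counterexample without disturbing the condition or the tuple meant to realise `p`.
    positive-witness : ∀ {Γ} k (φ : Formula L (suc k)) e → Positive ((k , ¬̇ all φ , e) ∷ Γ) →
                       ∃[ m ] Positive ((suc k , ¬̇ φ , m ∷ e) ∷ Γ)
    positive-witness {Γ} k φ e pos with bounded e ⊗ bounded* Γ ⊗ bounded (iota n)
    ... | m , fresh = m , λ Δ pΔ → let (e< , Γ< , d<) = fresh m ≤-refl in
      case pos Δ pΔ of λ { (s , s¬∀ ∷ sΓ , sΔ) → case ¬∀⇒∃¬ s¬∀ of λ (a , ¬φa) →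
        s [ m ≔ a ] ,
        subst₂ (λ b ρ → ¬ Sat M (b ∷ ρ) φ) (sym (≔-same s m a)) (sym (≔-fresh s m a e<)) ¬φa ∷
        All.zipWith (λ { {k , ψ , d} (d<m , sψ) →
          subst (λ ρ → Sat M ρ ψ) (sym (≔-fresh s m a d<m)) sψ }) (Γ< , sΓ) ,
        subst (λ ρ → All (Sat M ρ) Δ) (sym (≔-fresh s m a d<)) sΔ }

    -- `Omit d χ` is meant to say that `χ` keeps the constants `d` from realising a type to be
    -- omitted. As every element of the limit is named by a constant, meeting this requirement for
    -- every `d` omits the type.
    module Generic (finsat : ∀ Δ → All p Δ → ∃[ ρ ] All (Sat M ρ) Δ)
                   (Omit : Vec ℕ n → Instance 0 → Set)
                   (omit-dense : ∀ d Γ → Positive Γ → ∃[ χ ] Omit d χ × Positive (χ ∷ Γ)) where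

      data Goal : Set where
        decide  : Instance 0 → Goal
        witness : Instance 1 → Goal
        omit    : Vec ℕ n → Goal

      Meets : Goal → Instance 0 → Set
      Meets (decide (k , φ , e))  χ = χ ≡ (k , φ , e) ⊎ χ ≡ (k , ¬̇ φ , e)
      Meets (witness (k , φ , e)) χ = χ ≡ (k , all φ , e) ⊎ (∃[ m ] χ ≡ (suc k , ¬̇ φ , m ∷ e))
      Meets (omit d)              χ = Omit d χ

      dense : ∀ g Γ → Positive Γ → ∃[ χ ] Meets g χ × Positive (χ ∷ Γ)
      dense (decide χ@(k , φ , e)) Γ pos with em {Positive (χ ∷ Γ)}
      ... | yes pos′ = χ , inj₁ refl , pos′
      ... | no ¬pos  = _ , inj₂ refl , positive-¬ k φ e pos ¬pos
      dense (witness (k , φ , e)) Γ pos with em {Positive ((k , all φ , e) ∷ Γ)}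
      ... | yes pos′ = _ , inj₁ refl , pos′
      ... | no ¬pos  with positive-witness k φ e (positive-¬ k (all φ) e pos ¬pos)
      ... | m , pos′ = _ , inj₂ (m , refl) , pos′
      dense (omit d) = omit-dense d

      goals : ℕ → List Goal
      goals j = List.map decide (instances 0 j) ++
        (List.map witness (instances 1 j) ++ List.map omit (vectors (List.upTo j) n))

      ∈-goals : ∀ g → ∃[ j ] g ∈ goals j
      ∈-goals (decide χ)  with ∈-instances 0 χ
      ... | j , ∈j = j , ∈.∈-++⁺ˡ (∈.∈-map⁺ decide (∈j j ≤-refl))
      ∈-goals (witness χ) with ∈-instances 1 χ
      ... | j , ∈j = j , ∈.∈-++⁺ʳ (List.map decide (instances 0 j))
        (∈.∈-++⁺ˡ (∈.∈-map⁺ witness (∈j j ≤-refl)))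
      ∈-goals (omit d)    with ∈-naturals d
      ... | j , ∈j = j , ∈.∈-++⁺ʳ (List.map decide (instances 0 j))
        (∈.∈-++⁺ʳ (List.map witness (instances 1 j)) (∈.∈-map⁺ omit (∈-vectors (∈j j ≤-refl))))

      State : Set
      State = Σ Condition Positive

      meetAll : List Goal → State → State
      meetAll []       x         = x
      meetAll (g ∷ gs) (Γ , pos) with dense g Γ pos
      ... | χ , _ , pos′ = meetAll gs (χ ∷ Γ , pos′)

      stage : ℕ → State
      stage zero    = [] , positive-[] finsat
      stage (suc j) = meetAll (goals j) (stage j)

      infix 4 _⊩*_
      _⊩*_ : Assignment → State → Set
      s ⊩* (Γ , _) = All (s ⊩_) Γ

      meetAll-extends : ∀ gs x {s} → s ⊩* meetAll gs x → s ⊩* x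
      meetAll-extends []       x         h = h
      meetAll-extends (g ∷ gs) (Γ , pos) h with dense g Γ pos
      ... | χ , _ , pos′ = All.tail (meetAll-extends gs (χ ∷ Γ , pos′) h)

      meetAll-meets : ∀ {g gs} → g ∈ gs → ∀ x →
                      ∃[ χ ] Meets g χ × (∀ s → s ⊩* meetAll gs x → s ⊩ χ)
      meetAll-meets {gs = g ∷ gs} (here refl) (Γ , pos) with dense g Γ pos
      ... | χ , meets , pos′ = χ , meets , λ s h → All.head (meetAll-extends gs (χ ∷ Γ , pos′) h)
      meetAll-meets {gs = g ∷ gs} (there g∈)  (Γ , pos) with dense g Γ pos
      ... | χ , meets , pos′ = meetAll-meets g∈ (χ ∷ Γ , pos′)

      stage-extends : ∀ j i {s} → s ⊩* stage (i + j) → s ⊩* stage j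
      stage-extends j zero    h = h
      stage-extends j (suc i) h = stage-extends j i (meetAll-extends (goals (i + j)) (stage (i + j)) h)

      stage-mono : ∀ {j k s} → j ≤ k → s ⊩* stage k → s ⊩* stage j
      stage-mono {j} {k} {s} j≤k h =
        stage-extends j (k ∸ j) (subst (λ k → s ⊩* stage k) (sym (m∸n+n≡m j≤k)) h)

      F : (Assignment → Set) → Set
      F P = ∃[ j ] ∀ s → s ⊩* stage j → P s

      F-pure : ∀ {P} → (∀ s → P s) → F P
      F-pure h = 0 , λ s _ → h s

      F-zip : ∀ {P Q R : Assignment → Set} → (∀ {s} → P s → Q s → R s) → F P → F Q → F R
      F-zip f (j , p) (k , q) = j ⊔ k , λ s h →
        f (p s (stage-mono (m≤m⊔n j k) h)) (q s (stage-mono (m≤n⊔m j k) h))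

      F-proper : ∀ {P} → F P → ∃ P
      -- Positivity, tested against no formulas of `p`, yields an assignment that meets the stage.
      F-proper (j , p) with proj₂ (stage j) [] []
      ... | s , h , _ = s , p s h

      F-meets : ∀ g → ∃[ χ ] Meets g χ × F (_⊩ χ)
      F-meets g with ∈-goals g
      ... | j , g∈ with meetAll-meets g∈ (stage j)
      ... | χ , meets , forced = χ , meets , suc j , forced

      F-decides : ∀ {k} φ (e : Vec ℕ k) →
                  F (λ s → Sat M (Vec.map s e) φ) ⊎ F (λ s → ¬ Sat M (Vec.map s e) φ)
      F-decides {k} φ e with F-meets (decide (k , φ , e))
      ... | _ , inj₁ refl , f = inj₁ f
      ... | _ , inj₂ refl , f = inj₂ f

      F-witness : ∀ {k} φ (e : Vec ℕ k) → F (λ s → Sat M (Vec.map s e) (all φ)) ⊎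
                  (∃[ m ] F (λ s → ¬ Sat M (s m ∷ Vec.map s e) φ))
      F-witness {k} φ e with F-meets (witness (k , φ , e))
      ... | _ , inj₁ refl       , f = inj₁ f
      ... | _ , inj₂ (m , refl) , f = inj₂ (m , f)

      -- The negation cannot be the one decided, since positivity of the deciding stage, tested
      -- against `φ` alone, yields an assignment that satisfies `φ`.
      F-p : ∀ {φ} → p φ → F (λ s → Sat M (Vec.map s (iota n)) φ)
      F-p {φ} pφ with F-decides φ (iota n)
      ... | inj₁ f       = f
      ... | inj₂ (j , f) with proj₂ (stage j) (φ ∷ []) (pφ ∷ [])
      ... | s , h , sφ ∷ [] = contradiction sφ (f s h)

      filter : GenericFilter M
      filter = record { F = F ; F-pure = F-pure ; F-zip = F-zip ; F-proper = F-proper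
                      ; F-decides = F-decides ; F-witness = F-witness }

    opaque
      -- One construction for two purposes: with a trivial `Omit` it realises `p`, and with an empty
      -- `p` it omits a type.
      generic : (∀ Δ → All p Δ → ∃[ ρ ] All (Sat M ρ) Δ) →
                (Omit : Vec ℕ n → Instance 0 → Set) →
                (∀ d Γ → Positive Γ → ∃[ χ ] Omit d χ × Positive (χ ∷ Γ)) →
                Σ[ 𝓕 ∈ GenericFilter M ] let open GenericFilter 𝓕 in
                  (∀ {φ} → p φ → F (λ s → Sat M (Vec.map s (iota n)) φ)) ×
                  (∀ d → ∃[ χ ] Omit d χ × F (_⊩ χ))
      generic finsat Omit omit-dense =
        G.filter , G.F-p , λ d → G.F-meets (G.omit d)
        where module G = Generic finsat Omit omit-dense

  -- The Ryll-Nardzewski theorem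

  module _ {L : Language} {M N : Structure L} where

    -- Inclusion of types is equality because types contain the negation of whatever they lack.
    SameType-sym : ∀ {n} {ρ : Vec (Structure.Carrier M) n} {ρ′ : Vec (Structure.Carrier N) n} →
                   SameType M N ρ ρ′ → SameType N M ρ′ ρ
    SameType-sym ρ~ρ′ φ p = stable (λ ¬q → ρ~ρ′ (¬̇ φ) ¬q p)

  module _ {L : Language} (fin : FiniteLanguage L) (M : Structure L)
           (point : Structure.Carrier M) (ωcat : ωCategorical M) where
    open Structure M
    open Enumeration fin using (Instance)

    limit-≅ : (𝓕 : GenericFilter M) → Limit.model 𝓕 ≅ M
    limit-≅ 𝓕 = ωcat model model-countable model-≡ₑ
      where open Limit 𝓕

    opaque
      -- The first `n` constants realise `p` in a generic limit, and categoricity carries them over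
      -- to `M`. The condition demanded for omission is a tautology.
      realise : ∀ {n} (p : Formula L n → Set) → (∀ Δ → All p Δ → ∃[ ρ ] All (Sat M ρ) Δ) →
                ∃[ ρ ] (∀ {φ} → p φ → Sat M ρ φ)
      realise {n} p finsat with Henkin.generic fin M point p finsat (λ _ _ → ⊤)
        (λ d Γ pos → (0 , falsum ⊃ falsum , []) , tt ,
          λ Δ pΔ → case pos Δ pΔ of λ (s , sΓ , sΔ) → s , id ∷ sΓ , sΔ)
      ... | 𝓕 , F-p , _ = Vec.map (_≅_.to (limit-≅ 𝓕)) (Vec.map element (iota n)) , λ {φ} pφ →
        Equivalence.to (sat-≅ (limit-≅ 𝓕) _ φ) (Equivalence.from (truth φ (iota n)) (F-p pφ))
        where open Limit 𝓕

    -- "The constants d satisfy the formula x̄ when Γ does", with the constants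
    -- of Γ and d (assumed to be at most K) quantified existentially.
    module Describe {n} (Γ : List (Instance 0)) (d : Vec ℕ n) (K : ℕ) where
      open Henkin fin M point {n} (λ _ → ⊥) using (_⊩_)

      -- The constants in use are below `suc K`, so reduction modulo `suc K` leaves them unchanged
      -- and only makes the function total. The successor keeps the modulus nonzero.
      old : ℕ → Fin (suc K + n)
      old i = (i mod suc K) ↑ˡ n

      conjunctsΓ : List (Formula L (suc K + n))
      conjunctsΓ = List.map (λ (k , φ , e) → rename (old ∘ lookup e) φ) Γ

      conjunctsd : List (Formula L (suc K + n))
      conjunctsd = List.map (λ j → var (old (lookup d j)) ≐ var (suc K ↑ʳ j)) (List.allFin n)

      formula : Formula L n
      formula = ∃̇^ (suc K) (⋀ (conjunctsΓ ++ conjunctsd))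

      clamped : Vec Carrier (suc K) → ℕ → Carrier
      clamped v i = lookup v (i mod suc K)

      clamped-lookup : ∀ v (ρ : Vec Carrier n) {k} (e : Vec ℕ k) i →
                       lookup (Vec.map (clamped v) e) i ≡ lookup (v Vec.++ ρ) (old (lookup e i))
      clamped-lookup v ρ e i =
        trans (Vec.lookup-map i _ e) (sym (Vec.lookup-++ˡ v ρ (lookup e i mod suc K)))

      sound : ∀ {ρ} → Sat M ρ formula → ∃[ s ] All (s ⊩_) Γ × Vec.map s d ≡ ρ
      sound {ρ} h with Equivalence.to (sat-∃^ M (suc K) _) h
      ... | v , h′ with Equivalence.to (sat-⋀ M (conjunctsΓ ++ conjunctsd)) h′
      ... | hs = clamped v ,
        All.map (λ { {k , φ , e} → Equivalence.from (sat-rename M (clamped-lookup v ρ e) φ) })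
          (All.map⁻ (All.++⁻ˡ conjunctsΓ hs)) ,
        (begin
          Vec.map (clamped v) d                        ≡⟨ Vec.tabulate∘lookup _ ⟨
          Vec.tabulate (lookup (Vec.map (clamped v) d)) ≡⟨ Vec.tabulate-cong (λ j → trans
            (clamped-lookup v ρ d j) (trans (All.lookup (All.map⁻ (All.++⁻ʳ conjunctsΓ hs)) (∈.∈-allFin j))
              (Vec.lookup-++ʳ v ρ j))) ⟩
          Vec.tabulate (lookup ρ)                      ≡⟨ Vec.tabulate∘lookup ρ ⟩
          ρ                                            ∎)
        where open ≡-Reasoning

      module _ (s : ℕ → Carrier) where
        initial : Vec Carrier (suc K)
        initial = Vec.tabulate (s ∘ toℕ)

        clamped-< : ∀ {i} → i < suc K → clamped initial i ≡ s i
        clamped-< {i} i<K = trans (Vec.lookup∘tabulate (s ∘ toℕ) (i mod suc K))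
          (cong s (trans (Fin.toℕ-fromℕ< _) (m<n⇒m%n≡m i<K)))

        map-clamped : ∀ {k} {e : Vec ℕ k} → VAll (_< suc K) e →
                      Vec.map (clamped initial) e ≡ Vec.map s e
        map-clamped []           = refl
        map-clamped (i<K ∷ e<K) = cong₂ _∷_ (clamped-< i<K) (map-clamped e<K)

        complete : All (λ (k , φ , e) → VAll (_< suc K) e) Γ → VAll (_< suc K) d →
                   All (s ⊩_) Γ → Sat M (Vec.map s d) formula
        complete Γ<K d<K sΓ = Equivalence.from (sat-∃^ M (suc K) _) (initial ,
          Equivalence.from (sat-⋀ M (conjunctsΓ ++ conjunctsd)) (All.++⁺
            (All.map⁺ (All.zipWith (λ { {k , φ , e} (e<K , sφ) →
              Equivalence.to (sat-rename M (clamped-lookup initial (Vec.map s d) e) φ)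
                (subst (λ ρ → Sat M ρ φ) (sym (map-clamped e<K)) sφ) }) (Γ<K , sΓ)))
            (All.map⁺ (All.tabulate (λ {j} _ → trans
              (sym (clamped-lookup initial (Vec.map s d) d j))
              (trans (cong (λ ρ → lookup ρ j) (map-clamped d<K))
                (sym (Vec.lookup-++ʳ initial (Vec.map s d) j))))))))

    opaque
      describe : ∀ {n} (Γ : List (Instance 0)) (d : Vec ℕ n) →
                 let open Henkin fin M point {n} (λ _ → ⊥) using (_⊩_) in
                 ∃[ φ ] (∀ s → All (s ⊩_) Γ → Sat M (Vec.map s d) φ) ×
                        (∀ {ρ} → Sat M ρ φ → ∃[ s ] All (s ⊩_) Γ × Vec.map s d ≡ ρ)
      describe {n} Γ d with bounded d ⊗ Henkin.bounded* fin M point {n} (λ _ → ⊥) Γ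
      ... | K , bounds = formula ,
          (λ s → complete s (proj₂ (bounds (suc K) (n≤1+n K))) (proj₁ (bounds (suc K) (n≤1+n K)))) , sound
        where open Describe Γ d K

    Isolated : ∀ {n} → Vec Carrier n → Set
    Isolated ρ = ∃[ φ ] Sat M ρ φ × (∀ ρ′ → Sat M ρ′ φ → SameType M M ρ ρ′)

    module Omission {n} (ρ : Vec Carrier n) (non-isolated : ¬ Isolated ρ) where
      open Henkin fin M point {n} (λ _ → ⊥)

      Omit : Vec ℕ n → Instance 0 → Set
      Omit d χ = ∃[ ψ ] χ ≡ (n , ψ , d) × ¬ Sat M ρ ψ

      -- If there were none, every tuple satisfying `φ` would share the type of `ρ`. As `φ` holds at
      -- `ρ₀`, it would then hold at `ρ` too and isolate `ρ`.
      separated : ∀ {ρ₀} φ → Sat M ρ₀ φ → ∃[ ρ′ ] Sat M ρ′ φ × ∃[ ψ ] ¬ Sat M ρ ψ × Sat M ρ′ ψ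
      separated {ρ₀} φ h = stable λ ∄ →
        let isolates = λ ρ′ h′ ψ p → stable λ ¬p′ → ∄ (ρ′ , h′ , ¬̇ ψ , (λ ¬p → ¬p p) , ¬p′) in
        non-isolated (φ , SameType-sym {M = M} {M} (isolates ρ₀ h) φ h , isolates)

      -- What `Γ` says about `d` amounts to a single formula `φ`. Since it does not isolate `ρ`,
      -- some tuple satisfies `φ` together with a `ψ` that fails at `ρ`.
      dense : ∀ d Γ → Positive Γ → ∃[ χ ] Omit d χ × Positive (χ ∷ Γ)
      dense d Γ pos =
        let (s , sΓ , _)                 = pos [] []
            (φ , complete , sound)       = describe Γ d
            (ρ′ , ρ′φ , ψ , ¬ρψ , ρ′ψ)   = separated φ (complete s sΓ)
            (s′ , s′Γ , eq)              = sound ρ′φ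
        in (n , ψ , d) , (ψ , refl , ¬ρψ) ,
           λ { [] [] → s′ , subst (λ ρ → Sat M ρ ψ) (sym eq) ρ′ψ ∷ s′Γ , [] }

      -- The isomorphism with `M` takes some tuple of the limit to `ρ`. The requirement for the
      -- constants of that tuple forces a formula on it that fails at `ρ`.
      absurd : (𝓕 : GenericFilter M) →
               ¬ (∀ d → ∃[ χ ] Omit d χ × GenericFilter.F 𝓕 (_⊩ χ))
      absurd 𝓕 omits = contradicts (omits (Vec.map proj₁ preimage))
        where
        open Limit 𝓕
        open GenericFilter 𝓕 using (F)

        preimage : Vec Element n
        preimage = Vec.map (to⁻¹ (limit-≅ 𝓕)) ρ

        image : Vec.map (_≅_.to (limit-≅ 𝓕)) preimage ≡ ρ
        image = trans (sym (Vec.map-∘ _ _ ρ))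
          (trans (Vec.map-cong (to∘to⁻¹ (limit-≅ 𝓕)) ρ) (Vec.map-id ρ))

        contradicts : ¬ (∃[ χ ] Omit (Vec.map proj₁ preimage) χ × F (_⊩ χ))
        contradicts (_ , (ψ , refl , ¬ρψ) , f) = ¬ρψ (subst (λ ρ → Sat M ρ ψ) image
          (Equivalence.to (sat-≅ (limit-≅ 𝓕) preimage ψ)
            (subst (λ as → Sat model as ψ) (elements-proj₁ preimage)
              (Equivalence.from (truth ψ (Vec.map proj₁ preimage)) f))))

    opaque
      isolate : ∀ {n} (ρ : Vec Carrier n) → Isolated ρ
      isolate {n} ρ = stable λ non-isolated → let open Omission ρ non-isolated in
        case Henkin.generic fin M point {n} (λ _ → ⊥) (λ { [] [] → ρ , [] }) Omit dense of λ
          (𝓕 , _ , omits) → absurd 𝓕 omits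

    -- With infinitely many types, the formulas that fail for only finitely many of them would be
    -- finitely satisfiable and hence satisfied by a single `ρ`. But the negation of the formula
    -- isolating `ρ` is such a formula.
    finitelyManyTypes : ∀ n → FinitelyManyUpTo (SameType M M {n})
    finitelyManyTypes n = stable λ infinite →
      let (ρ , ρ⊨p)            = realise Cofinite (finsat infinite)
          (φ , ρ⊨φ , isolates) = isolate ρ
      in ρ⊨p {¬̇ φ} (ρ ∷ [] , λ ρ′ ¬¬φ → here (SameType-sym {M = M} {M} (isolates ρ′ (stable ¬¬φ)))) ρ⊨φ
      where
      Cofinite : Formula L n → Set
      Cofinite φ = Σ[ ρs ∈ List (Vec Carrier n) ]
        (∀ ρ → ¬ Sat M ρ φ → Any (SameType M M ρ) ρs)

      cofinite-⋀ : ∀ {Δ} → All Cofinite Δ → Σ[ ρs ∈ List (Vec Carrier n) ]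
                   (∀ ρ → ¬ All (Sat M ρ) Δ → Any (SameType M M ρ) ρs)
      cofinite-⋀ []                           = [] , λ ρ ¬[] → contradiction [] ¬[]
      cofinite-⋀ {φ ∷ Δ} ((ρs , covers) ∷ cof) with cofinite-⋀ cof
      ... | ρs′ , covers′ = ρs ++ ρs′ , λ ρ ¬all → case em {Sat M ρ φ} of λ
        { (yes p) → Any.++⁺ʳ ρs (covers′ ρ (λ ps → ¬all (p ∷ ps)))
        ; (no ¬p) → Any.++⁺ˡ (covers ρ ¬p) }

      finsat : ¬ FinitelyManyUpTo (SameType M M {n}) →
               ∀ Δ → All Cofinite Δ → ∃[ ρ ] All (Sat M ρ) Δ
      finsat infinite Δ cof with cofinite-⋀ cof
      ... | ρs , covers = stable λ ∄ → infinite (ρs , λ ρ → covers ρ (λ h → ∄ (ρ , h)))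

  -- Back and forth

  record BackAndForth (X Y : Set) : Set₁ where
    infix 4 _⊑_
    field
      State      : Set
      In         : State → X → Y → Set
      functional : ∀ s {x y y′} → In s x y → In s x y′ → y ≡ y′
      injective  : ∀ s {x x′ y} → In s x y → In s x′ y → x ≡ x′

    _⊑_ : State → State → Set
    s ⊑ t = ∀ {x y} → In s x y → In t x y

    field
      forth : ∀ s x → Σ[ t ∈ State ] s ⊑ t × ∃[ y ] In t x y
      back  : ∀ s y → Σ[ t ∈ State ] s ⊑ t × ∃[ x ] In t x y

  module _ {X Y : Set} (X-countable : Countable X) (Y-countable : Countable Y)
           (B : BackAndForth X Y) where
    open BackAndForth B
    private
      module X = Injection X-countable
      module Y = Injection Y-countable

    -- Step `k` takes care of the element with code `k`, if there is one.
    forth-at : ∀ k s → Σ[ t ∈ State ] s ⊑ t × (∀ x → X.to x ≡ k → ∃[ y ] In t x y)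
    forth-at k s with em {∃[ x ] X.to x ≡ k}
    ... | no ∄          = s , id , λ x eq → contradiction (x , eq) ∄
    ... | yes (x , refl) with forth s x
    ... | t , s⊑t , y , xy = t , s⊑t , λ x′ eq → y , subst (λ x → In t x y) (X.injective (sym eq)) xy

    back-at : ∀ k s → Σ[ t ∈ State ] s ⊑ t × (∀ y → Y.to y ≡ k → ∃[ x ] In t x y)
    back-at k s with em {∃[ y ] Y.to y ≡ k}
    ... | no ∄          = s , id , λ y eq → contradiction (y , eq) ∄
    ... | yes (y , refl) with back s y
    ... | t , s⊑t , x , xy = t , s⊑t , λ y′ eq → x , subst (In t x) (Y.injective (sym eq)) xy

    module _ (s₀ : State) where
      chain : ℕ → State
      half  : ℕ → State
      half k = proj₁ (forth-at k (chain k))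
      chain zero    = s₀
      chain (suc k) = proj₁ (back-at k (half k))

      chain-half : ∀ k → chain k ⊑ half k
      chain-half k = proj₁ (proj₂ (forth-at k (chain k)))

      half-chain : ∀ k → half k ⊑ chain (suc k)
      half-chain k = proj₁ (proj₂ (back-at k (half k)))

      chain-+ : ∀ j i → chain j ⊑ chain (i + j)
      chain-+ j zero    xy = xy
      chain-+ j (suc i) xy = half-chain (i + j) (chain-half (i + j) (chain-+ j i xy))

      chain-≤ : ∀ {j k} → j ≤ k → chain j ⊑ chain k
      chain-≤ {j} {k} j≤k {x} {y} xy =
        subst (λ k → In (chain k) x y) (m∸n+n≡m j≤k) (chain-+ j (k ∸ j) xy)

      image : ∀ x → ∃[ y ] In (chain (suc (X.to x))) x y
      image x with proj₂ (proj₂ (forth-at (X.to x) (chain (X.to x)))) x refl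
      ... | y , xy = y , half-chain (X.to x) xy

      preimage : ∀ y → ∃[ x ] In (chain (suc (Y.to y))) x y
      preimage y = proj₂ (proj₂ (back-at (Y.to y) (half (Y.to y)))) y refl

      limit : X → Y
      limit x = proj₁ (image x)

      limit-chain : ∀ x → Eventually (λ k → In (chain k) x (limit x))
      limit-chain x = suc (X.to x) , λ k ≤k → chain-≤ ≤k (proj₂ (image x))

      chain-limit : ∀ {k x y} → In (chain k) x y → limit x ≡ y
      chain-limit {k} {x} xy with limit-chain x
      ... | j , ev = functional (chain (j ⊔ k)) (ev _ (m≤m⊔n j k)) (chain-≤ (m≤n⊔m j k) xy)

      limit-injective : ∀ {x x′} → limit x ≡ limit x′ → x ≡ x′
      limit-injective {x} {x′} eq with limit-chain x ⊗ limit-chain x′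
      ... | k , ev with ev k ≤-refl
      ... | xy , x′y = injective (chain k) xy (subst (In (chain k) x′) (sym eq) x′y)

      limit-surjective : ∀ y → ∃[ x ] (∀ {z} → z ≡ x → limit z ≡ y)
      limit-surjective y with preimage y
      ... | x , xy = x , λ { refl → chain-limit xy }

      limit-vector : ∀ {n} (xs : Vec X n) →
                     Eventually (λ k → ∀ i → In (chain k) (lookup xs i) (limit (lookup xs i)))
      limit-vector []       = always (λ _ ())
      limit-vector (x ∷ xs) = eventually-map
        (λ (xy , xys) → λ { zero → xy ; (suc i) → xys i }) (limit-chain x ⊗ limit-vector xs)

      opaque
        -- The last component puts finitely many values of the bijection into a single state, where
        -- claims such as the preservation of an operation can be checked.
        backAndForth : Σ[ f ∈ X ⤖ Y ] let open Bijection f using (to) in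
          (∀ {x y} → In s₀ x y → to x ≡ y) ×
          (∀ {n} (xs : Vec X n) → Σ[ s ∈ State ] (∀ i → In s (lookup xs i) (to (lookup xs i))))
        backAndForth = mk⤖ (limit-injective , limit-surjective) , chain-limit {0} ,
          λ xs → let (k , ev) = limit-vector xs in chain k , ev k ≤-refl

  -- Isomorphisms from equality of types

  ≡ₑ-refl : ∀ {L} {M : Structure L} → M ≡ₑ M
  ≡ₑ-refl φ = mk⇔ id id

  module _ {L : Language} (M : Structure L)
           (finTypes : ∀ n → FinitelyManyUpTo (SameType M M {n})) where

    -- Phrased by sentences, so that it passes from `M` to every structure with the same theory.
    Complete : ∀ {n} → Formula L n → Set
    Complete {n} φ = ∀ ψ → M ⊨ close n (φ ⊃ ψ) ⊎ M ⊨ close n (φ ⊃ ¬̇ ψ)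

    separate : ∀ {n} ρ (ρs : List (Vec (Structure.Carrier M) n)) →
               ∃[ φ ] Sat M ρ φ × All (λ ρ′ → Sat M ρ′ φ → SameType M M ρ ρ′) ρs
    separate ρ []        = (falsum ⊃ falsum) , id , []
    separate ρ (ρ′ ∷ ρs) with separate ρ ρs | em {SameType M M ρ ρ′}
    ... | φ , p , seps | yes ρ~ρ′ = φ , p , (λ _ → ρ~ρ′) ∷ seps
    ... | φ , p , seps | no ρ≁ρ′ with ¬∀⇒∃¬ ρ≁ρ′
    ... | ψ , ¬imp = φ ∧̇ ψ ,
      Equivalence.from (sat-∧ M φ ψ) (p , stable (λ ¬q → ¬imp (λ q → contradiction q ¬q))) ,
      (λ h → contradiction (λ _ → proj₂ (Equivalence.to (sat-∧ M φ ψ) h)) ¬imp) ∷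
      All.map (λ sep h → sep (proj₁ (Equivalence.to (sat-∧ M φ ψ) h))) seps

    isolator : ∀ {n} (ρ : Vec (Structure.Carrier M) n) → ∃[ φ ] Sat M ρ φ × Complete φ
    isolator {n} ρ with finTypes n
    ... | ρs , covers with separate ρ ρs
    ... | φ , p , seps = φ , p , complete
      where
      isolates : ∀ ρ′ → Sat M ρ′ φ → SameType M M ρ ρ′
      isolates ρ′ h ψ q with All.lookupAny seps (covers ρ′)
      ... | sep , ρ′~r = SameType-sym {M = M} {M} ρ′~r ψ (sep (ρ′~r φ h) ψ q)

      complete : Complete φ
      complete ψ with em {Sat M ρ ψ}
      ... | yes q = inj₁ (Equivalence.from (sat-close M n _) (λ ρ′ h → isolates ρ′ h ψ q))
      ... | no ¬q = inj₂ (Equivalence.from (sat-close M n _) (λ ρ′ h → isolates ρ′ h (¬̇ ψ) ¬q))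

    -- Finitely many complete formulas cover the n-tuples of M, hence those of N.
    atomic : ∀ {N : Structure L} → N ≡ₑ M → ∀ {n} (ρ : Vec (Structure.Carrier N) n) →
             ∃[ φ ] Sat N ρ φ × Complete φ
    atomic {N} N≡M {n} ρ with finTypes n
    ... | ρs , covers = stable λ ∄ →
      Equivalence.to (sat-close N n cover)
        (Equivalence.from (N≡M (close n cover)) (Equivalence.from (sat-close M n cover) covered)) ρ
        (Equivalence.from (sat-⋀ N (List.map (λ r → ¬̇ formula r) ρs))
          (All.map⁺ (All.tabulate {xs = ρs} (λ {r} _ p → ∄ (formula r , p , proj₂ (proj₂ (isolator r)))))))
      where
      formula : Vec (Structure.Carrier M) n → Formula L n
      formula r = proj₁ (isolator r)

      cover : Formula L n
      cover = ¬̇ ⋀ (List.map (λ r → ¬̇ formula r) ρs)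

      covered : ∀ ρ′ → Sat M ρ′ cover
      covered ρ′ h
        with All.lookupAny (All.map⁻ (Equivalence.to (sat-⋀ M (List.map (λ r → ¬̇ formula r) ρs)) h)) (covers ρ′)
      ... | ¬p , ρ′~r = ¬p (SameType-sym {M = M} {M} ρ′~r (formula r) (proj₁ (proj₂ (isolator r))))
        where
        r : Vec (Structure.Carrier M) n
        r = Any.lookup (covers ρ′)

    -- A complete formula `φ` holds at `a ∷ ρ`. Its existential quantification belongs to the type
    -- of `ρ`, hence to that of `ρ′`, and by completeness any witness has the type of `a`.
    extend : ∀ {A B : Structure L} → A ≡ₑ M → B ≡ₑ M → ∀ {n ρ ρ′} → SameType A B {n} ρ ρ′ →
             ∀ a → ∃[ b ] SameType A B (a ∷ ρ) (b ∷ ρ′)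
    extend {A} {B} A≡M B≡M {n} {ρ} {ρ′} ρ~ρ′ a with atomic A≡M (a ∷ ρ)
    ... | φ , p , complete
      with Equivalence.to (sat-∃ B φ) (ρ~ρ′ (∃̇ φ) (Equivalence.from (sat-∃ A φ) (a , p)))
    ... | b , q = b , λ ψ r → case complete ψ of λ
      { (inj₁ imp) → Equivalence.to (sat-close B (suc n) (φ ⊃ ψ))
          (Equivalence.from (B≡M (close (suc n) (φ ⊃ ψ))) imp) (b ∷ ρ′) q
      ; (inj₂ imp) → contradiction r (Equivalence.to (sat-close A (suc n) (φ ⊃ ¬̇ ψ))
          (Equivalence.from (A≡M (close (suc n) (φ ⊃ ¬̇ ψ))) imp) (a ∷ ρ) p) }

    module _ {A B : Structure L} (A-countable : Countable (Structure.Carrier A))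
             (B-countable : Countable (Structure.Carrier B)) (A≡M : A ≡ₑ M) (B≡M : B ≡ₑ M) where
      private
        module A = Structure A
        module B = Structure B

      typeGame : BackAndForth A.Carrier B.Carrier
      typeGame = record
        { State      = ∃[ n ] Σ[ ρ ∈ Vec A.Carrier n ] Σ[ ρ′ ∈ Vec B.Carrier n ] SameType A B ρ ρ′
        ; In         = λ (_ , ρ , ρ′ , _) a b → ∃[ i ] lookup ρ i ≡ a × lookup ρ′ i ≡ b
        ; functional = λ { (_ , _ , _ , ρ~ρ′) (i , eq , refl) (j , refl , refl) →
                           ρ~ρ′ (var i ≐ var j) eq }
        ; injective  = λ { (_ , _ , _ , ρ~ρ′) (i , refl , eq) (j , refl , refl) →
                           SameType-sym {M = A} {B} ρ~ρ′ (var i ≐ var j) eq }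
        ; forth      = λ (_ , ρ , ρ′ , ρ~ρ′) a → let (b , ~) = extend A≡M B≡M ρ~ρ′ a in
                       (_ , a ∷ ρ , b ∷ ρ′ , ~) , (λ (i , eqs) → suc i , eqs) , b , zero , refl , refl
        ; back       = λ (_ , ρ , ρ′ , ρ~ρ′) b →
                       let (a , ~) = extend B≡M A≡M (SameType-sym {M = A} {B} ρ~ρ′) b in
                       (_ , a ∷ ρ , b ∷ ρ′ , SameType-sym {M = B} {A} ~) ,
                       (λ (i , eqs) → suc i , eqs) , a , zero , refl , refl
        }

      opaque
        SameType⇒≅ : ∀ {n ρ ρ′} → SameType A B {n} ρ ρ′ → Σ[ σ ∈ A ≅ B ] Vec.map (_≅_.to σ) ρ ≡ ρ′
        SameType⇒≅ {n} {ρ} {ρ′} ρ~ρ′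
          with backAndForth A-countable B-countable typeGame (n , ρ , ρ′ , ρ~ρ′)
        ... | f , extends , agrees = record
          { bijection     = f
          ; preserves-op  = preserves-op
          ; preserves-rel = preserves-rel
          } , map-ρ
          where
          open Bijection f using (to)

          map-ρ : Vec.map to ρ ≡ ρ′
          map-ρ = begin
            Vec.map to ρ                          ≡⟨ Vec.tabulate∘lookup _ ⟨
            Vec.tabulate (lookup (Vec.map to ρ))  ≡⟨ Vec.tabulate-cong (λ i →
              trans (Vec.lookup-map i to ρ) (extends (i , refl , refl))) ⟩
            Vec.tabulate (lookup ρ′)              ≡⟨ Vec.tabulate∘lookup ρ′ ⟩
            ρ′                                    ∎
            where open ≡-Reasoning

          evals-positions : ∀ (N : Structure L) {m k} (ζ : Vec (Structure.Carrier N) m) (f : Fin k → Fin m)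
                            xs → (∀ i → lookup ζ (f i) ≡ lookup xs i) → evals N ζ (vars f) ≡ xs
          evals-positions N ζ f xs eq =
            trans (evals-vars N f ζ) (trans (Vec.tabulate-cong eq) (Vec.tabulate∘lookup xs))

          preserves-op : ∀ {k} (g : Language.Op L k) xs → to (A.opᴵ g xs) ≡ B.opᴵ g (Vec.map to xs)
          -- The value and the arguments lie in a common state, and equality of types transfers the
          -- equation between their positions.
          preserves-op {k} g xs with agrees (A.opᴵ g xs ∷ xs)
          ... | (m , ζ , ζ′ , ζ~ζ′) , at with at zero
          ... | i , ζi , ζ′i = begin
            to (A.opᴵ g xs)                        ≡⟨ ζ′i ⟨
            lookup ζ′ i                            ≡⟨ ζ~ζ′ (var i ≐ app g (vars pos))
              (trans ζi (cong (A.opᴵ g) (sym (evals-positions A ζ pos xs (λ j → proj₁ (proj₂ (at (suc j)))))))) ⟩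
            B.opᴵ g (evals B ζ′ (vars pos))        ≡⟨ cong (B.opᴵ g) (evals-positions B ζ′ pos _
              (λ j → trans (proj₂ (proj₂ (at (suc j)))) (sym (Vec.lookup-map j to xs)))) ⟩
            B.opᴵ g (Vec.map to xs)                ∎
            where
            open ≡-Reasoning
            pos : Fin k → Fin m
            pos j = proj₁ (at (suc j))

          preserves-rel : ∀ {k} (r : Language.Rel L k) xs → A.relᴵ r xs ⇔ B.relᴵ r (Vec.map to xs)
          preserves-rel {k} r xs with agrees xs
          ... | (m , ζ , ζ′ , ζ~ζ′) , at = mk⇔
            (λ h → subst (B.relᴵ r) eqB (ζ~ζ′ (rel r (vars pos)) (subst (A.relᴵ r) (sym eqA) h)))
            (λ h → subst (A.relᴵ r) eqA (SameType-sym {M = A} {B} ζ~ζ′ (rel r (vars pos))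
              (subst (B.relᴵ r) (sym eqB) h)))
            where
            pos : Fin k → Fin m
            pos j = proj₁ (at j)

            eqA : evals A ζ (vars pos) ≡ xs
            eqA = evals-positions A ζ pos xs (λ j → proj₁ (proj₂ (at j)))

            eqB : evals B ζ′ (vars pos) ≡ Vec.map to xs
            eqB = evals-positions B ζ′ pos _
              (λ j → trans (proj₂ (proj₂ (at j))) (sym (Vec.lookup-map j to xs)))

  Oligomorphic : ∀ {L} → Structure L → Set
  Oligomorphic M = ∀ n → FinitelyManyUpTo (SameTupleOrbit M {n})

  opaque
    ωCategorical⇒Oligomorphic : ∀ {L} → FiniteLanguage L → (M : Structure L) →
                                Structure.Carrier M → Countable (Structure.Carrier M) →
                                ωCategorical M → Oligomorphic M
    ωCategorical⇒Oligomorphic fin M point M-countable ωcat n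
      with finTypes ← finitelyManyTypes fin M point ωcat
      with finTypes n
    ... | ρs , covers = ρs , λ ρ → Any.map
      (SameType⇒≅ M finTypes M-countable M-countable (≡ₑ-refl {M = M}) (≡ₑ-refl {M = M})) (covers ρ)

    Oligomorphic⇒ωCategorical : ∀ {L} (M : Structure L) → Countable (Structure.Carrier M) →
                                Oligomorphic M → ωCategorical M
    Oligomorphic⇒ωCategorical M M-countable oligo N N-countable N≡M =
      proj₁ (SameType⇒≅ M finTypes N-countable M-countable N≡M (≡ₑ-refl {M = M})
        {ρ = []} {[]} (λ φ → Equivalence.to (N≡M φ)))
      where
      finTypes : ∀ n → FinitelyManyUpTo (SameType M M {n})
      finTypes n with oligo n
      ... | ρs , covers = ρs , λ ρ → Any.map (SameTupleOrbit⇒SameType M) (covers ρ)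

  -- From `x`, apply `φ` and then the inverse of `l`, again and again, until the range of `l` is
  -- left. Each round uses up a pair of `l`, so this ends. The path never meets a pair twice, since
  -- `φ` is injective on good elements and `x` is outside the domain.
  chase : {X Y : Set} (φ : X → Y) (Good : X → Set) →
          (∀ {s t} → Good s → Good t → φ s ≡ φ t → s ≡ t) →
          ∀ l → Acc _<_ (length l) →
          (∀ {s y y′} → (s , y) ∈ l → (s , y′) ∈ l → y ≡ y′) →
          (∀ {s t} → Good s → (t , φ s) ∈ l → Good t) →
          ∀ x → Good x → (∀ y → (x , y) ∉ l) →
          ∃[ s ] Good s × (s ≡ x ⊎ (∃[ y ] (s , y) ∈ l)) × (∀ t → (t , φ s) ∉ l)
  chase φ Good inj l (acc rs) func step x good x∉l with em {∃[ t ] (t , φ x) ∈ l}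
  ... | no ∄        = x , good , inj₁ refl , λ t t∈ → ∄ (t , t∈)
  ... | yes (t , t∈) = result
    where
    P : _ → Set
    P p = p ≢ (t , φ x)

    l′ : List _
    l′ = List.filter {P = P} (λ _ → em) l

    l′⊆l : ∀ {p} → p ∈ l′ → p ∈ l
    l′⊆l p∈ = proj₁ (∈.∈-filter⁻ {P = P} (λ _ → em) {xs = l} p∈)

    result : ∃[ s ] Good s × (s ≡ x ⊎ (∃[ y ] (s , y) ∈ l)) × (∀ u → (u , φ s) ∉ l)
    result with chase φ Good inj l′
      (rs (List.filter-notAll {P = P} (λ _ → em) l (lose t∈ (λ p → p refl))))
      (λ p q → func (l′⊆l p) (l′⊆l q)) (λ g q → step g (l′⊆l q)) t (step good t∈)
      (λ y p → proj₂ (∈.∈-filter⁻ {P = P} (λ _ → em) {xs = l} p) (cong (t ,_) (func (l′⊆l p) t∈)))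
    ... | s , good-s , s≡t⊎s∈ , s-free = s , good-s , inj₂ s∈l , free
      where
      s∈l : ∃[ y ] (s , y) ∈ l
      s∈l = [ (λ { refl → _ , t∈ }) , (λ (y , p) → y , l′⊆l p) ]′ s≡t⊎s∈

      free : ∀ u → (u , φ s) ∉ l
      -- The removed pair cannot block `φ s` either: then `φ s` would equal `φ x`, so `s` would be
      -- `x`, but `s` is in the domain of `l`.
      free u u∈ = s-free u (∈.∈-filter⁺ {P = P} (λ _ → em) u∈ λ eq →
        x∉l _ (subst (λ s → (s , proj₁ s∈l) ∈ l) (inj good-s good (cong proj₂ eq)) (proj₂ s∈l)))

  infinite-pigeonhole : {X : Set} {P : ℕ → X → Set} {xs : List X} → (∀ n → Any (P n) xs) →
                        ∃₂ λ i j → i < j × (∃[ x ] P i x × P j x)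
  infinite-pigeonhole {P = P} {xs} anys
    with Fin.pigeonhole (n<1+n (length xs)) (Any.index ∘ anys ∘ toℕ)
  ... | i , j , i<j , eq = toℕ i , toℕ j , i<j , _ , Any.lookup-index (anys (toℕ i)) ,
    subst (λ k → P (toℕ j) (List.lookup xs k)) (sym eq) (Any.lookup-index (anys (toℕ j)))

  -- The given representatives may lie outside the image of `f`, so each is replaced by a point
  -- whose image is related to it, if there is one.
  pullback : {X Y : Set} {R : X → X → Set} (f : Y → X) → (∀ {a b x} → R a x → R b x → R a b) →
             FinitelyManyUpTo R → FinitelyManyUpTo (λ y y′ → R (f y) (f y′))
  pullback {X} {Y} {R} f euclidean (xs , covers) =
    let (ys , covers′) = go xs in ys , λ y → covers′ y (covers (f y))
    where
    go : ∀ xs → Σ[ ys ∈ List Y ] (∀ y → Any (R (f y)) xs → Any (λ y′ → R (f y) (f y′)) ys)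
    go []       = [] , λ _ ()
    go (x ∷ xs) with go xs | em {∃[ y ] R (f y) x}
    ... | ys , covers | yes (y₀ , r₀) = y₀ ∷ ys , λ
      { y (here r) → here (euclidean r r₀) ; y (there a) → there (covers y a) }
    ... | ys , covers | no ∄          = ys , λ
      { y (here r) → contradiction (y , r) ∄ ; y (there a) → covers y a }

  -- Monounary algebras

  module Unary (𝒜 : MonounaryAlgebra) where
    open MonounaryAlgebra 𝒜

    θ^-suc : ∀ n x → θ^ n (θ x) ≡ θ (θ^ n x)
    θ^-suc zero    x = refl
    θ^-suc (suc n) x = cong θ (θ^-suc n x)

    θ^-+ : ∀ m n x → θ^ (m + n) x ≡ θ^ m (θ^ n x)
    θ^-+ m n x = fold-+ x θ m

    θ^-comm : ∀ m n x → θ^ m (θ^ n x) ≡ θ^ n (θ^ m x)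
    θ^-comm m n x = trans (sym (θ^-+ m n x)) (trans (cong (λ k → θ^ k x) (+-comm m n)) (θ^-+ n m x))

    θ^-period : ∀ k {p x} → θ^ p x ≡ x → θ^ (k * p) x ≡ x
    θ^-period zero          eq = refl
    θ^-period (suc k) {p} {x} eq = trans (θ^-+ p (k * p) x) (trans (cong (θ^ p) (θ^-period k eq)) eq)

    cyclic-θ^ : ∀ k {x} → Cyclic x → Cyclic (θ^ k x)
    cyclic-θ^ k {x} (n , eq) = n , trans (θ^-comm (suc n) k x) (cong (θ^ k) eq)

    cyclic-≤ : ∀ {m n x} → m ≤ n → Cyclic (θ^ m x) → Cyclic (θ^ n x)
    cyclic-≤ {m} {n} {x} m≤n c = subst Cyclic
      (trans (sym (θ^-+ (n ∸ m) m x)) (cong (λ k → θ^ k x) (m∸n+n≡m m≤n))) (cyclic-θ^ (n ∸ m) c)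

    automorphism : (f : Carrier → Carrier) → (∀ {x y} → f x ≡ f y → x ≡ y) → (∀ y → ∃[ x ] f x ≡ y) →
                   (∀ x → f (θ x) ≡ θ (f x)) → structure ≅ structure
    automorphism f inj surj comm = record
      { bijection     = mk⤖ (inj , λ y → let (x , eq) = surj y in x , λ { refl → eq })
      ; preserves-op  = λ { θ̇ (x ∷ []) → comm x }
      ; preserves-rel = λ ()
      }

    module _ (σ : structure ≅ structure) where
      open _≅_ σ using (to)

      to-θ : ∀ x → to (θ x) ≡ θ (to x)
      to-θ x = _≅_.preserves-op σ θ̇ (x ∷ [])

      to-θ^ : ∀ n x → to (θ^ n x) ≡ θ^ n (to x)
      to-θ^ zero    x = refl
      to-θ^ (suc n) x = trans (to-θ (θ^ n x)) (cong θ (to-θ^ n x))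

      to-cyclic : ∀ {x} → Cyclic x → Cyclic (to x)
      to-cyclic (n , eq) = n , trans (sym (to-θ^ (suc n) _)) (cong to eq)

      to-cyclic⁻ : ∀ {x} → Cyclic (to x) → Cyclic x
      to-cyclic⁻ (n , eq) = n , to-injective σ (trans (to-θ^ (suc n) _) eq)

    Child : Carrier → Carrier → Set
    Child v x = θ x ≡ v × ¬ Cyclic x

    Embeds : (Carrier → Carrier → Set) → Carrier → Carrier → Set
    Embeds R v z = Σ[ φ ∈ (Carrier → Carrier) ]
      (∀ {x} → Child v x → Child z (φ x) × R x (φ x)) ×
      (∀ {x x′} → Child v x → Child v x′ → φ x ≡ φ x′ → x ≡ x′)

    -- The cycle of a connected algebra

    module Cycle (connected : Connected) {c : Carrier} (c-cyclic : Cyclic c) where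

      cycle : List Carrier
      cycle = List.applyUpTo (λ i → θ^ i c) (suc (proj₁ c-cyclic))

      θ^-∈cycle : ∀ n → θ^ n c ∈ cycle
      θ^-∈cycle zero    = here refl
      θ^-∈cycle (suc n) with ∈.∈-applyUpTo⁻ (λ i → θ^ i c) (θ^-∈cycle n)
      ... | i , i<p , eq with m≤n⇒m<n∨m≡n i<p
      ... | inj₁ 1+i<p = subst (_∈ cycle) (cong θ (sym eq)) (∈.∈-applyUpTo⁺ (λ i → θ^ i c) 1+i<p)
      ... | inj₂ refl  = subst (_∈ cycle) (trans (sym (proj₂ c-cyclic)) (cong θ (sym eq))) (here refl)

      ∈cycle⇒cyclic : ∀ {x} → x ∈ cycle → Cyclic x
      ∈cycle⇒cyclic x∈ with ∈.∈-applyUpTo⁻ (λ i → θ^ i c) x∈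
      ... | i , _ , refl = cyclic-θ^ i c-cyclic

      -- Of the `n * suc q` steps that lead from `x` back to `x`, the first `n` reach `θ^ m c`, so
      -- `x` is itself a power of `θ` at `c`.
      cyclic⇒∈cycle : ∀ {x} → Cyclic x → x ∈ cycle
      cyclic⇒∈cycle {x} (q , eq) with connected x c
      ... | n , m , eq′ = subst (_∈ cycle) (begin
        θ^ (n * q + m) c        ≡⟨ θ^-+ (n * q) m c ⟩
        θ^ (n * q) (θ^ m c)     ≡⟨ cong (θ^ (n * q)) eq′ ⟨
        θ^ (n * q) (θ^ n x)     ≡⟨ θ^-+ (n * q) n x ⟨
        θ^ (n * q + n) x        ≡⟨ cong (λ k → θ^ k x) (trans (+-comm (n * q) n) (sym (*-suc n q))) ⟩
        θ^ (n * suc q) x        ≡⟨ θ^-period n eq ⟩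
        x                       ∎) (θ^-∈cycle (n * q + m))
        where open ≡-Reasoning

      eventually-cyclic : ∀ x → ∃[ n ] Cyclic (θ^ n x)
      eventually-cyclic x with connected x c
      ... | n , m , eq = n , subst Cyclic (sym eq) (cyclic-θ^ m c-cyclic)

    -- Extending finite partial automorphisms

    module Core (countable : Countable Carrier) (connected : Connected)
                {c : Carrier} (c-cyclic : Cyclic c) (h : ℕ) (bounded-height : ∀ x → Cyclic (θ^ h x))
                (T : Carrier → Carrier → Set) (T-sym : ∀ {x y} → T x y → T y x)
                (T-children : ∀ {v z} → T v z → Embeds T v z)
                (T-finite : FinitelyManyUpTo T) where
      open Cycle connected c-cyclic

      -- The relations T of interest need not be transitive, but their child
      -- embeddings compose.
      T* : Carrier → Carrier → Set
      T* = Star T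

      T*-sym : ∀ {x y} → T* x y → T* y x
      T*-sym = reverse T-sym

      T*-children : ∀ {v z} → T* v z → Embeds T* v z
      T*-children ε        = id , (λ ch → ch , ε) , λ _ _ eq → eq
      T*-children (t ◅ ts) with T-children t | T*-children ts
      ... | φ , φ-child , φ-inj | ψ , ψ-child , ψ-inj = ψ ∘ φ ,
        (λ ch → let (ch′ , u) = φ-child ch ; (ch″ , us) = ψ-child ch′ in ch″ , u ◅ us) ,
        (λ ch ch′ eq → φ-inj ch ch′ (ψ-inj (proj₁ (φ-child ch)) (proj₁ (φ-child ch′)) eq))

      -- Domain and range contain all cyclic elements, so every vertex still to be added is acyclic,
      -- and closure under `θ` lets it be attached as a child of a vertex already present.
      record PartialAutomorphism : Set where
        field
          graph      : List (Carrier × Carrier)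
          functional : ∀ {x y y′} → (x , y) ∈ graph → (x , y′) ∈ graph → y ≡ y′
          injective  : ∀ {x x′ y} → (x , y) ∈ graph → (x′ , y) ∈ graph → x ≡ x′
          closed     : ∀ {x y} → (x , y) ∈ graph → (θ x , θ y) ∈ graph
          typed      : ∀ {x y} → (x , y) ∈ graph → T* x y
          dom-cyclic : ∀ {x} → Cyclic x → ∃[ y ] (x , y) ∈ graph
          cod-cyclic : ∀ {y} → Cyclic y → ∃[ x ] (x , y) ∈ graph

        closed^ : ∀ n {x y} → (x , y) ∈ graph → (θ^ n x , θ^ n y) ∈ graph
        closed^ zero    xy = xy
        closed^ (suc n) xy = closed (closed^ n xy)

        cyclic-cod : ∀ {x y} → (x , y) ∈ graph → Cyclic x → Cyclic y
        cyclic-cod {x} {y} xy (n , eq) =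
          n , functional (subst (λ x → (x , θ^ (suc n) y) ∈ graph) eq (closed^ (suc n) xy)) xy

      open PartialAutomorphism

      swap : Carrier × Carrier → Carrier × Carrier
      swap (x , y) = y , x

      ∈-swap⁻ : ∀ {x y l} → (x , y) ∈ List.map swap l → (y , x) ∈ l
      ∈-swap⁻ p with ∈.∈-map⁻ swap p
      ... | _ , q , refl = q

      flip : PartialAutomorphism → PartialAutomorphism
      flip f = record
        { graph      = List.map swap (graph f)
        ; functional = λ p q → injective f (∈-swap⁻ p) (∈-swap⁻ q)
        ; injective  = λ p q → functional f (∈-swap⁻ p) (∈-swap⁻ q)
        ; closed     = λ p → ∈.∈-map⁺ swap (closed f (∈-swap⁻ p))
        ; typed      = λ p → T*-sym (typed f (∈-swap⁻ p))
        ; dom-cyclic = λ c → let (x , p) = cod-cyclic f c in x , ∈.∈-map⁺ swap p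
        ; cod-cyclic = λ c → let (y , p) = dom-cyclic f c in y , ∈.∈-map⁺ swap p
        }

      add : ∀ f {x y} → (∀ y → (x , y) ∉ graph f) → (∀ x → (x , y) ∉ graph f) →
            (θ x , θ y) ∈ graph f → T* x y → PartialAutomorphism
      add f {x} {y} x∉ y∉ θxy t = record
        { graph      = (x , y) ∷ graph f
        ; functional = λ { (here refl) (here refl) → refl
                         ; (here refl) (there q)   → contradiction q (x∉ _)
                         ; (there p)   (here refl) → contradiction p (x∉ _)
                         ; (there p)   (there q)   → functional f p q }
        ; injective  = λ { (here refl) (here refl) → refl
                         ; (here refl) (there q)   → contradiction q (y∉ _)
                         ; (there p)   (here refl) → contradiction p (y∉ _)
                         ; (there p)   (there q)   → injective f p q }
        ; closed     = λ { (here refl) → there θxy ; (there p) → there (closed f p) }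
        ; typed      = λ { (here refl) → t ; (there p) → typed f p }
        ; dom-cyclic = λ c → let (y , p) = dom-cyclic f c in y , there p
        ; cod-cyclic = λ c → let (x , p) = cod-cyclic f c in x , there p
        }

      infix 4 _⊆_
      _⊆_ : PartialAutomorphism → PartialAutomorphism → Set
      f ⊆ g = ∀ {x y} → (x , y) ∈ graph f → (x , y) ∈ graph g

      -- If z has the type of θ x, then x can be mapped to some φ s, where s is
      -- reached from x by alternately applying φ and the inverse of f.
      extend-child : ∀ f x {z} → (∀ y → (x , y) ∉ graph f) → (θ x , z) ∈ graph f →
                     Σ[ g ∈ PartialAutomorphism ] f ⊆ g × ∃[ y ] (x , y) ∈ graph g
      extend-child f x {z} x∉ θxz with T*-children (typed f θxz)
      ... | φ , φ-child , φ-inj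
        -- The good vertices are the children of `θ x` linked to `x` by `T*`, so that pairing `x`
        -- with the final `φ s` respects both `θ` and `T*`.
        with chase φ (λ s → Child (θ x) s × T* x s) (λ (ch , _) (ch′ , _) → φ-inj ch ch′)
          (graph f) (<-wellFounded _) (functional f)
          (λ { {s} {t} (ch , xs) q → let ((θφs≡z , φs-acyclic) , s-φs) = φ-child ch in
            (injective f (subst (λ y → (θ t , y) ∈ graph f) θφs≡z (closed f q)) θxz ,
             (λ c → φs-acyclic (cyclic-cod f q c))) ,
            xs ◅◅ s-φs ◅◅ T*-sym (typed f q) })
          x ((refl , λ c → let (y , p) = dom-cyclic f c in x∉ y p) , ε) x∉
      ... | s , (ch , xs) , _ , free with φ-child ch
      ... | (θφs≡z , _) , s-φs =
        add f x∉ free (subst (λ y → (θ x , y) ∈ graph f) (sym θφs≡z) θxz) (xs ◅◅ s-φs) ,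
        there , φ s , here refl

      -- Induction on the number of steps to the cycle: `θ x` is added before `x`, which keeps the
      -- graph closed.
      extend-dom : ∀ n f x → Cyclic (θ^ n x) →
                   Σ[ g ∈ PartialAutomorphism ] f ⊆ g × ∃[ y ] (x , y) ∈ graph g
      extend-dom zero    f x c = f , id , dom-cyclic f c
      extend-dom (suc n) f x c with extend-dom n f (θ x) (subst Cyclic (sym (θ^-suc n x)) c)
      ... | g , f⊆g , z , θxz with em {∃[ y ] (x , y) ∈ graph g}
      ... | yes x∈ = g , f⊆g , x∈
      ... | no  x∉ with extend-child g x (λ y p → x∉ (y , p)) θxz
      ... | k , g⊆k , x∈ = k , g⊆k ∘ f⊆g , x∈

      game : BackAndForth Carrier Carrier
      game = record
        { State      = PartialAutomorphism
        ; In         = λ f x y → (x , y) ∈ graph f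
        ; functional = λ f → functional f
        ; injective  = λ f → injective f
        ; forth      = λ f x → extend-dom h f x (bounded-height x)
        ; back       = λ f y → let (g , f⊆g , x , p) = extend-dom h (flip f) y (bounded-height y) in
                       flip g , (λ p → ∈.∈-map⁺ swap (f⊆g (∈.∈-map⁺ swap p))) , x , ∈.∈-map⁺ swap p
        }

      realised : ∀ f → Σ[ σ ∈ structure ≅ structure ] (∀ {x y} → (x , y) ∈ graph f → _≅_.to σ x ≡ y)
      realised f with backAndForth countable countable game f
      ... | σ , extends , agrees = automorphism to (Bijection.injective σ)
        (λ y → let (x , eq) = Bijection.surjective σ y in x , eq refl) commutes , extends
        where
        open Bijection σ using (to)
        commutes : ∀ x → to (θ x) ≡ θ (to x)
        commutes x with agrees (x ∷ θ x ∷ [])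
        ... | g , at = functional g (at (suc zero)) (closed g (at zero))

      -- The cycle together with the subalgebra generated by `xs`. It is a finite list because `h`
      -- steps lead into the cycle.
      closure : List Carrier → List Carrier
      closure xs = List.concatMap (λ x → List.applyUpTo (λ i → θ^ i x) (suc h)) xs ++ cycle

      cyclic⇒∈closure : ∀ {xs x} → Cyclic x → x ∈ closure xs
      cyclic⇒∈closure {xs} c = ∈.∈-++⁺ʳ _ (cyclic⇒∈cycle c)

      ⊆closure : ∀ {xs x} → x ∈ xs → x ∈ closure xs
      ⊆closure x∈ = ∈.∈-++⁺ˡ (∈.∈-concatMap⁺ _ (lose x∈ (here refl)))

      closure-closed : ∀ {xs x} → x ∈ closure xs → θ x ∈ closure xs
      closure-closed {xs} x∈ with ∈.∈-++⁻ (List.concatMap (λ x → List.applyUpTo (λ i → θ^ i x) (suc h)) xs) x∈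
      ... | inj₂ x∈cycle = cyclic⇒∈closure {xs} (cyclic-θ^ 1 (∈cycle⇒cyclic x∈cycle))
      ... | inj₁ x∈paths with find (∈.∈-concatMap⁻ _ {xs = xs} x∈paths)
      ... | a , a∈ , x∈a with ∈.∈-applyUpTo⁻ (λ i → θ^ i a) x∈a
      ... | i , i<1+h , refl with m≤n⇒m<n∨m≡n i<1+h
      ... | inj₁ 1+i<1+h = ∈.∈-++⁺ˡ (∈.∈-concatMap⁺ _ (lose a∈ (∈.∈-applyUpTo⁺ (λ i → θ^ i a) 1+i<1+h)))
      ... | inj₂ refl    = cyclic⇒∈closure {xs} (cyclic-θ^ 1 (bounded-height a))

      identity : List Carrier → PartialAutomorphism
      identity xs = record
        { graph      = List.map diagonal (closure xs)
        ; functional = λ p q → trans (sym (diagonal⁻ p)) (diagonal⁻ q)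
        ; injective  = λ p q → trans (diagonal⁻ p) (sym (diagonal⁻ q))
        ; closed     = closed′
        ; typed      = λ p → subst (T* _) (diagonal⁻ p) ε
        ; dom-cyclic = λ c → _ , ∈.∈-map⁺ diagonal (cyclic⇒∈closure {xs} c)
        ; cod-cyclic = λ c → _ , ∈.∈-map⁺ diagonal (cyclic⇒∈closure {xs} c)
        }
        where
        diagonal : Carrier → Carrier × Carrier
        diagonal x = x , x

        diagonal⁻ : ∀ {x y} → (x , y) ∈ List.map diagonal (closure xs) → x ≡ y
        diagonal⁻ p with ∈.∈-map⁻ diagonal p
        ... | _ , _ , refl = refl

        closed′ : ∀ {x y} → (x , y) ∈ List.map diagonal (closure xs) →
                  (θ x , θ y) ∈ List.map diagonal (closure xs)
        closed′ p with ∈.∈-map⁻ diagonal p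
        ... | _ , q , refl = ∈.∈-map⁺ diagonal (closure-closed {xs} q)

      -- The identity on the closure of `xs`, enlarged by the pair of `x` and `y`, is a finite
      -- partial automorphism, and any automorphism extending it fixes `xs`.
      conjugate : ∀ xs {x y} → x ∉ closure xs → y ∉ closure xs → θ x ≡ θ y → θ x ∈ closure xs → T* x y →
                  Σ[ σ ∈ structure ≅ structure ] _≅_.to σ x ≡ y × (∀ {z} → z ∈ xs → _≅_.to σ z ≡ z)
      conjugate xs {x} {y} x∉ y∉ θx≡θy θx∈ t with realised
        (add (identity xs) (λ z p → x∉ (dom p)) (λ z p → y∉ (cod p))
          (subst (λ z → (θ x , z) ∈ graph (identity xs)) θx≡θy (∈.∈-map⁺ _ θx∈)) t)
        where
        dom : ∀ {x y} → (x , y) ∈ graph (identity xs) → x ∈ closure xs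
        dom p with ∈.∈-map⁻ _ p
        ... | _ , q , refl = q

        cod : ∀ {x y} → (x , y) ∈ graph (identity xs) → y ∈ closure xs
        cod p with ∈.∈-map⁻ _ p
        ... | _ , q , refl = q
      ... | σ , extends = σ , extends (here refl) , λ z∈ → extends (there (∈.∈-map⁺ _ (⊆closure z∈)))

      map-fixed : ∀ {n} {f : Carrier → Carrier} (ρ : Vec Carrier n) →
                  (∀ {z} → z ∈ Vec.toList ρ → f z ≡ z) → Vec.map f ρ ≡ ρ
      map-fixed []      fixed = refl
      map-fixed (x ∷ ρ) fixed = cong₂ _∷_ (fixed (here refl)) (map-fixed ρ (fixed ∘ there))

      -- Outside a finite closure, preimages of `z` linked by `T*` are conjugate over `ρ`, so one
      -- for each class of `T` suffices. The closure itself is listed.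
      fibre : ∀ {n} (ρ : Vec Carrier n) z → Σ[ ys ∈ List Carrier ]
              (∀ x → θ x ≡ z → Any (λ y → SameTupleOrbit structure (x ∷ ρ) (y ∷ ρ)) ys)
      fibre ρ z = closure xs ++ List.map choose (proj₁ T-finite) , covers
        where
        xs : List Carrier
        xs = z ∷ Vec.toList ρ

        Candidate : Carrier → Carrier → Set
        Candidate t y = y ∉ closure xs × θ y ≡ z × T* y t

        choose : Carrier → Carrier
        choose t with em {∃ (Candidate t)}
        ... | yes (y , _) = y
        -- Without a candidate any entry will do, since no preimage has to be covered by it.
        ... | no  _       = t

        choose-spec : ∀ {t x} → Candidate t x → Candidate t (choose t)
        choose-spec {t} {x} cand with em {∃ (Candidate t)}
        ... | yes (_ , cand′) = cand′
        ... | no  ∄           = contradiction (x , cand) ∄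

        covers : ∀ x → θ x ≡ z → Any (λ y → SameTupleOrbit structure (x ∷ ρ) (y ∷ ρ)) _
        covers x θx≡z with em {x ∈ closure xs}
        ... | yes x∈ = Any.++⁺ˡ (lose x∈ orbit-refl)
        ... | no  x∉ = Any.++⁺ʳ (closure xs) (Any.map⁺ (Any.map conj (proj₂ T-finite x)))
          where
          conj : ∀ {t} → T x t → SameTupleOrbit structure (x ∷ ρ) (choose t ∷ ρ)
          conj x~t with choose-spec (x∉ , θx≡z , x~t ◅ ε)
          ... | y∉ , θy≡z , y~t with conjugate xs x∉ y∉ (trans θx≡z (sym θy≡z))
                (subst (_∈ closure xs) (sym θx≡z) (⊆closure {xs} (here refl))) ((x~t ◅ ε) ◅◅ T*-sym y~t)
          ... | σ , σx≡y , fixed = σ , cong₂ _∷_ σx≡y (map-fixed ρ (fixed ∘ there))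

      -- Induction on the distance from the cycle. An automorphism fixing `ρ` moves `θ x` to a
      -- representative `z`, and then `x` to a preimage of `z`, which `fibre` covers.
      stabiliser-orbits : ∀ d {n} (ρ : Vec Carrier n) → Σ[ ys ∈ List Carrier ]
        (∀ x → Cyclic (θ^ d x) → Any (λ y → SameTupleOrbit structure (x ∷ ρ) (y ∷ ρ)) ys)
      stabiliser-orbits zero    ρ = cycle , λ x c → lose (cyclic⇒∈cycle c) orbit-refl
      stabiliser-orbits (suc d) ρ with stabiliser-orbits d ρ
      ... | zs , covers = List.concatMap (λ z → proj₁ (fibre ρ z)) zs , λ x c →
        Any.concat⁺ (Any.map⁺ (Any.map lift (covers (θ x) (subst Cyclic (sym (θ^-suc d x)) c))))
        where
        lift : ∀ {x z} → SameTupleOrbit structure (θ x ∷ ρ) (z ∷ ρ) →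
               Any (λ y → SameTupleOrbit structure (x ∷ ρ) (y ∷ ρ)) (proj₁ (fibre ρ z))
        lift {x} {z} (σ , eq) = Any.map
          (orbit-trans (σ , cong (_≅_.to σ x ∷_) (Vec.∷-injectiveʳ eq)))
          (proj₂ (fibre ρ z) (_≅_.to σ x) (trans (sym (to-θ σ x)) (Vec.∷-injectiveˡ eq)))

      opaque
        oligomorphic : Oligomorphic structure
        oligomorphic zero    = [] ∷ [] , λ { [] → here orbit-refl }
        oligomorphic (suc n) with oligomorphic n
        ... | ρs , covers = List.concatMap (λ ρ → List.map (_∷ ρ) (proj₁ (stabiliser-orbits h ρ))) ρs , λ
          { (x ∷ ρ) → Any.concat⁺ (Any.map⁺ (Any.map (λ { {ρ′} (σ , refl) →
              Any.map⁺ (Any.map (orbit-trans (σ , refl))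
                (proj₂ (stabiliser-orbits h ρ′) (_≅_.to σ x) (bounded-height _))) }) (covers ρ))) }

    periodic⇒cyclic : ∀ {i j x} → i < j → θ^ i x ≡ θ^ j x → Cyclic (θ^ i x)
    periodic⇒cyclic {i} {suc j} {x} (s≤s i≤j) eq = j ∸ i , (begin
      θ^ (suc (j ∸ i)) (θ^ i x)  ≡⟨ θ^-+ (suc (j ∸ i)) i x ⟨
      θ^ (suc (j ∸ i) + i) x     ≡⟨ cong (λ k → θ^ (suc k) x) (m∸n+n≡m i≤j) ⟩
      θ^ (suc j) x               ≡⟨ eq ⟨
      θ^ i x                     ∎)
      where open ≡-Reasoning

    opaque
      bounded-height : ∀ {T : Carrier → Carrier → Set} → FinitelyManyUpTo T → (∀ x → ∃[ n ] Cyclic (θ^ n x)) →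
                       (∀ n {x y} → T x y → Cyclic (θ^ n y) → Cyclic (θ^ n x)) →
                       ∃[ h ] (∀ x → Cyclic (θ^ h x))
      bounded-height (xs , covers) eventually-cyclic T-height
        with eventually-All (λ x → let (n , c) = eventually-cyclic x in n , λ j n≤j → cyclic-≤ n≤j c) xs
      ... | h , ev = h , λ x → let (y , y∈ , x~y) = find (covers x) in
        T-height h x~y (All.lookup (ev h ≤-refl) y∈)

    -- Trees

    inTree : ∀ {z} (t : Tree z) → InTree z (value t)
    inTree (x , [ p ]) = recompute em p

    Tree-≡ : ∀ {z} {s t : Tree z} → value s ≡ value t → s ≡ t
    Tree-≡ {s = x , [ p ]} {t = .x , [ q ]} refl = refl

    root : ∀ z → Tree z
    root z = z , [ inj₁ refl ]

    tree-countable : Countable Carrier → ∀ z → Countable (Tree z)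
    tree-countable countable z = mk↣ {to = Injection.to countable ∘ value}
      (λ eq → Tree-≡ (Injection.injective countable eq))

    inTree-cyclic : ∀ {z x} → InTree z x → Cyclic x → x ≡ z
    inTree-cyclic (inj₁ x≡z)        c = x≡z
    inTree-cyclic (inj₂ (¬c , _)) c = contradiction c ¬c

    inTree-θ : ∀ {z x} → InTree z x → x ≡ z ⊎ InTree z (θ x)
    inTree-θ (inj₁ x≡z)                     = inj₁ x≡z
    inTree-θ (inj₂ (¬c , zero , eq , _))    = inj₂ (inj₁ eq)
    inTree-θ {x = x} (inj₂ (¬c , suc n , eq , ¬c′)) = inj₂ (inj₂
      ( (λ c → ¬c′ (subst Cyclic (θ^-suc n x) (cyclic-θ^ n c)))
      , n , trans (θ^-suc (suc n) x) eq , λ c → ¬c′ (subst Cyclic (θ^-suc n x) c)))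

    inTree-child : ∀ {z v x} → InTree z v → Child v x → InTree z x
    inTree-child (inj₁ refl) (θx≡v , ¬c) = inj₂ (¬c , 0 , θx≡v , ¬c)
    inTree-child {x = x} (inj₂ (_ , n , eq , ¬c′)) (refl , ¬c) =
      inj₂ (¬c , suc n , trans (sym (θ^-suc (suc n) x)) eq , λ c → ¬c′ (subst Cyclic (sym (θ^-suc n x)) c))

    -- Children of a vertex of a tree belong to the tree, so a map between trees restricts to them.
    -- The vertex and its image may lie anywhere in the two trees.
    embeds-by : ∀ {R : Carrier → Carrier → Set} {u v} (f : Tree u → Tree v) → (∀ {s t} → f s ≡ f t → s ≡ t) →
                (∀ t → R (value t) (value (f t))) →
                ∀ s → (∀ t → Child (value s) (value t) → Child (value (f s)) (value (f t))) →
                Embeds R (value s) (value (f s))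
    embeds-by {R} {u} f f-injective f-R s f-child = φ , φ-child , φ-injective
      where
      φ : Carrier → Carrier
      φ x with em {InTree u x}
      ... | yes p = value (f (x , [ p ]))
      -- This value is arbitrary, as no child of `s` lies outside the tree.
      ... | no  _ = x

      φ-value : ∀ t → φ (value t) ≡ value (f t)
      φ-value t with em {InTree u (value t)}
      ... | yes p = cong (value ∘ f) (Tree-≡ refl)
      ... | no ¬p = contradiction (inTree t) ¬p

      vertex : ∀ {x} → Child (value s) x → Tree u
      vertex {x} ch = x , [ inTree-child (inTree s) ch ]

      φ-child : ∀ {x} → Child (value s) x → Child (value (f s)) (φ x) × R x (φ x)
      φ-child ch rewrite φ-value (vertex ch) = f-child (vertex ch) ch , f-R (vertex ch)

      φ-injective : ∀ {x x′} → Child (value s) x → Child (value s) x′ → φ x ≡ φ x′ → x ≡ x′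
      φ-injective ch ch′ eq = cong value (f-injective {vertex ch} {vertex ch′} (Tree-≡
        (trans (sym (φ-value (vertex ch))) (trans eq (φ-value (vertex ch′))))))

    inTree-θ-acyclic : ∀ {z x} → Cyclic z → InTree z x → ¬ Cyclic x → InTree z (θ x)
    inTree-θ-acyclic c-z p ¬c with inTree-θ p
    ... | inj₁ refl = contradiction c-z ¬c
    ... | inj₂ q    = q

    module _ (σ : structure ≅ structure) where
      open _≅_ σ using (to)

      to-InTree : ∀ {z x} → InTree z x ⇔ InTree (to z) (to x)
      to-InTree {z} {x} = mk⇔
        (λ { (inj₁ refl)                   → inj₁ refl
           ; (inj₂ (¬c , n , refl , ¬c′)) → inj₂ ((λ c → ¬c (to-cyclic⁻ σ c)) , n , sym (to-θ^ σ (suc n) x) ,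
               λ c → ¬c′ (to-cyclic⁻ σ (subst Cyclic (sym (to-θ^ σ n x)) c))) })
        (λ { (inj₁ eq)                   → inj₁ (to-injective σ eq)
           ; (inj₂ (¬c , n , eq , ¬c′)) → inj₂ ((λ c → ¬c (to-cyclic σ c)) , n ,
               to-injective σ (trans (to-θ^ σ (suc n) x) eq) ,
               λ c → ¬c′ (subst Cyclic (to-θ^ σ n x) (to-cyclic σ c))) })

      restrict : ∀ {z z′} → to z ≡ z′ →
                 Σ[ τ ∈ partialAlgebra z ≅ᵖ partialAlgebra z′ ] (∀ t → value (_≅ᵖ_.to τ t) ≡ to (value t))
      restrict {z} refl = record
        { bijection     = mk⤖ ((λ eq → Tree-≡ (to-injective σ (cong value eq))) , surjective)
        ; preserves-Dom = λ t → mk⇔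
            (λ d → subst (InTree (to z)) (to-θ σ (value t)) (Equivalence.to to-InTree d))
            (λ d → Equivalence.from to-InTree (subst (InTree (to z)) (sym (to-θ σ (value t))) d))
        ; preserves-θ   = λ t d d′ → Tree-≡ (to-θ σ (value t))
        } , λ t → refl
        where
        f : Tree z → Tree (to z)
        f (x , [ p ]) = to x , [ Equivalence.to to-InTree p ]

        surjective : ∀ t → ∃[ s ] (∀ {s′} → s′ ≡ s → f s′ ≡ t)
        surjective t@(y , [ p ]) =
          (to⁻¹ σ y , [ Equivalence.from to-InTree (subst (InTree (to z)) (sym (to∘to⁻¹ σ y)) p) ]) ,
          λ { refl → Tree-≡ (to∘to⁻¹ σ y) }

    -- The root is the only vertex on which θ is undefined or the identity.
    Terminal : ∀ {z} → Tree z → Set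
    Terminal {z} t = ¬ InTree z (θ (value t)) ⊎ θ (value t) ≡ value t

    root-terminal : ∀ z → Terminal (root z)
    root-terminal z with em {InTree z (θ z)}
    ... | no  ¬d                        = inj₁ ¬d
    ... | yes (inj₁ eq)                 = inj₂ eq
    ... | yes (inj₂ (¬c , n , eq , _)) = contradiction (suc n , cong θ eq) ¬c

    terminal⇒root : ∀ {z} (t : Tree z) → Terminal t → value t ≡ z
    terminal⇒root t terminal with inTree t
    ... | inj₁ eq = eq
    ... | inj₂ p@(¬c , _) with inTree-θ (inj₂ p) | terminal
    ... | inj₁ eq | _       = eq
    ... | inj₂ d  | inj₁ ¬d = contradiction d ¬d
    ... | inj₂ d  | inj₂ eq = contradiction (0 , eq) ¬c

    -- Isomorphisms preserve being terminal, and this property singles out the root.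
    to-root-≅ᵖ : ∀ {u v} (φ : partialAlgebra u ≅ᵖ partialAlgebra v) → value (_≅ᵖ_.to φ (root u)) ≡ v
    to-root-≅ᵖ {u} {v} φ = terminal⇒root (to (root u)) (case root-terminal u of λ
      { (inj₁ ¬d) → inj₁ (¬d ∘ Equivalence.from (preserves-Dom (root u)))
      ; (inj₂ eq) → let d = inj₁ eq ; d′ = Equivalence.to (preserves-Dom (root u)) d in
          inj₂ (trans (sym (cong value (preserves-θ (root u) d d′))) (cong (value ∘ to) (Tree-≡ eq))) })
      where open _≅ᵖ_ φ

    ≅ᵖ-sym : ∀ {u v} → partialAlgebra u ≅ᵖ partialAlgebra v → partialAlgebra v ≅ᵖ partialAlgebra u
    ≅ᵖ-sym {u} {v} φ = record
      { bijection     = mk⤖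
          ( (λ eq → trans (sym (to∘from _)) (trans (cong to eq) (to∘from _)))
          , λ s → to s , λ { refl → Bijection.injective bijection (to∘from (to s)) })
      ; preserves-Dom = λ t → mk⇔
          (λ d → Equivalence.from (preserves-Dom (from t)) (subst (Dom v) (sym (to∘from t)) d))
          (λ d → subst (Dom v) (to∘from t) (Equivalence.to (preserves-Dom (from t)) d))
      ; preserves-θ   = λ t d d′ → Bijection.injective bijection (trans (to∘from _)
          (trans (Tree-≡ (cong (θ ∘ value) (sym (to∘from t))))
            (sym (preserves-θ (from t) d′ (Equivalence.to (preserves-Dom (from t)) d′)))))
      }
      where
      open _≅ᵖ_ φ

      Dom : ∀ z → Tree z → Set
      Dom z t = InTree z (θ (value t))

      from : Tree v → Tree u
      from t = proj₁ (Bijection.surjective bijection t)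

      to∘from : ∀ t → to (from t) ≡ t
      to∘from t = proj₂ (Bijection.surjective bijection t) refl

    -- Consequences of ω-categoricity

    module Consequences (countable : Countable Carrier) (connected : Connected)
                        (ωcat : ωCategorical structure) where

      opaque
        oligo : Oligomorphic structure
        oligo = ωCategorical⇒Oligomorphic finite structure inhabited countable ωcat
          where
          finite : FiniteLanguage monounaryLanguage
          finite = record { ops = (1 , θ̇) ∷ [] ; rels = [] ; ∈ops = λ { θ̇ → here refl } ; ∈rels = λ () }

      -- The powers of θ at x lie in distinct orbits of the stabiliser of x, unless they repeat.
      opaque
        periodic : ∀ x → ∃₂ λ i j → i < j × θ^ i x ≡ θ^ j x
        periodic x with infinite-pigeonhole (λ n → proj₂ (oligo 2) (x ∷ θ^ n x ∷ []))
        ... | i , j , i<j , _ , p , q with orbit-trans p (orbit-sym q)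
        ... | σ , eq = i , j , i<j , (begin
          θ^ i x              ≡⟨ cong (θ^ i) (Vec.∷-injectiveˡ eq) ⟨
          θ^ i (_≅_.to σ x)   ≡⟨ to-θ^ σ i x ⟨
          _≅_.to σ (θ^ i x)   ≡⟨ Vec.∷-injectiveˡ (Vec.∷-injectiveʳ eq) ⟩
          θ^ j x              ∎)
          where open ≡-Reasoning

      eventually-cyclic : ∀ x → ∃[ n ] Cyclic (θ^ n x)
      eventually-cyclic x = let (i , j , i<j , eq) = periodic x in i , periodic⇒cyclic i<j eq

      hasCyclic : ∃ Cyclic
      hasCyclic = let (n , c) = eventually-cyclic inhabited in θ^ n inhabited , c

      locallyFinite : LocallyFinite
      locallyFinite x xs = List.concatMap path (x ∷ xs) , λ y g → case generated⇒power g of λ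
        { (a , a∈ , n , refl) → ∈.∈-concatMap⁺ path (lose a∈ (∈path a n)) }
        where
        path : Carrier → List Carrier
        path a = List.applyUpTo (λ k → θ^ k a) (proj₁ (proj₂ (periodic a)))

        ∈path : ∀ a n → θ^ n a ∈ path a
        ∈path a n with periodic a
        ... | i , j , i<j , eq = go n
          where
          prefix : List Carrier
          prefix = List.applyUpTo (λ k → θ^ k a) j

          go : ∀ n → θ^ n a ∈ prefix
          go zero    = ∈.∈-applyUpTo⁺ (λ k → θ^ k a) (≤-<-trans z≤n i<j)
          go (suc n) with ∈.∈-applyUpTo⁻ (λ k → θ^ k a) (go n)
          ... | k , k<j , eq′ with m≤n⇒m<n∨m≡n k<j
          ... | inj₁ 1+k<j = subst (_∈ prefix) (cong θ (sym eq′)) (∈.∈-applyUpTo⁺ (λ k → θ^ k a) 1+k<j)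
          ... | inj₂ refl  = subst (_∈ prefix) (trans eq (cong θ (sym eq′))) (∈.∈-applyUpTo⁺ (λ k → θ^ k a) i<j)

        generated⇒power : ∀ {X y} → Generated X y → ∃[ a ] a ∈ X × (∃[ n ] θ^ n a ≡ y)
        generated⇒power (gen x∈)  = _ , x∈ , 0 , refl
        generated⇒power (step g) with generated⇒power g
        ... | a , a∈ , n , eq = a , a∈ , suc n , cong θ eq

      finitelyManyOrbits : FinitelyManyUpTo (SameOrbit structure)
      finitelyManyOrbits with oligo 1
      ... | ρs , covers = List.map Vec.head ρs , λ x →
        Any.map⁺ (Any.map (λ { {y ∷ []} (σ , eq) → σ , Vec.∷-injectiveˡ eq }) (covers (x ∷ [])))

      height : ∃[ h ] (∀ x → Cyclic (θ^ h x))
      height = bounded-height finitelyManyOrbits eventually-cyclic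
        λ { n (σ , refl) c → to-cyclic⁻ σ (subst Cyclic (sym (to-θ^ σ n _)) c) }

      finiteHeight : HasFiniteHeight
      finiteHeight = least (proj₁ height , λ x → let (m , isHeight) = least {λ n → Cyclic (θ^ n x)} (proj₁ height , proj₂ height x) in
        m , isHeight , proj₂ isHeight (proj₁ height) (proj₂ height x))

      finitelyManyTrees : FinitelyManyUpTo (λ x y → partialAlgebra x ≅ᵖ partialAlgebra y)
      finitelyManyTrees with finitelyManyOrbits
      ... | xs , covers = xs , λ x → Any.map (λ (σ , eq) → proj₁ (restrict σ eq)) (covers x)

      -- An automorphism between tuples that both begin with `c` fixes `c`, so it restricts to the
      -- tree at `c`.
      partialAlgebra-ωCategorical : ∀ c → ωCategoricalᵖ (partialAlgebra c)
      partialAlgebra-ωCategorical c n _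
        with pullback (λ ts → c ∷ Vec.map value ts) (λ p q → orbit-trans p (orbit-sym q)) (oligo (suc n))
      ... | tss , covers = tss , λ ts → Any.map (λ (σ , eq) →
          let (τ , τ-value) = restrict σ (Vec.∷-injectiveˡ eq) in
          τ , map-value⁻ (begin
            Vec.map value (Vec.map (_≅ᵖ_.to τ) ts)       ≡⟨ Vec.map-∘ value (_≅ᵖ_.to τ) ts ⟨
            Vec.map (value ∘ _≅ᵖ_.to τ) ts               ≡⟨ Vec.map-cong τ-value ts ⟩
            Vec.map (_≅_.to σ ∘ value) ts                ≡⟨ Vec.map-∘ (_≅_.to σ) value ts ⟩
            Vec.map (_≅_.to σ) (Vec.map value ts)        ≡⟨ Vec.∷-injectiveʳ eq ⟩
            _                                            ∎)) (covers ts)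
        where
        open ≡-Reasoning
        map-value⁻ : ∀ {n} {ss ts : Vec (Tree c) n} → Vec.map value ss ≡ Vec.map value ts → ss ≡ ts
        map-value⁻ {ss = []}     {[]}     _  = refl
        map-value⁻ {ss = s ∷ ss} {t ∷ ts} eq =
          cong₂ _∷_ (Tree-≡ (Vec.∷-injectiveˡ eq)) (map-value⁻ (Vec.∷-injectiveʳ eq))

    -- The order on the tree of a cyclic element

    module Order {c : Carrier} (c-cyclic : Cyclic c) where

      up : (t : Tree c) → ¬ Cyclic (value t) → Tree c
      up t ¬c = θ (value t) , [ inTree-θ-acyclic c-cyclic (inTree t) ¬c ]

      infix 4 _≼_
      _≼_ : Tree c → Tree c → Set
      s ≼ t = ∃[ k ] θ^ k (value t) ≡ value s

      cyclic⇒root : ∀ t → Cyclic (value t) → t ≡ root c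
      cyclic⇒root t cyc = Tree-≡ (inTree-cyclic (inTree t) cyc)

      root-≼ : ∀ t → root c ≼ t
      root-≼ t with inTree t
      ... | inj₁ eq                = 0 , eq
      ... | inj₂ (_ , n , eq , _) = suc n , eq

      ≼-root : ∀ t → t ≼ root c → t ≡ root c
      ≼-root t (k , eq) = cyclic⇒root t (subst Cyclic eq (cyclic-θ^ k c-cyclic))

      ≼-antisym : ∀ {s t} → s ≼ t → t ≼ s → s ≡ t
      ≼-antisym         (zero  , eq) _          = Tree-≡ (sym eq)
      ≼-antisym {s} {t} (suc k , eq) (l , eq′) = trans (cyclic⇒root s s-cyclic) (sym (cyclic⇒root t t-cyclic))
        where
        t-cyclic : Cyclic (value t)
        t-cyclic = l + k , (begin
          θ^ (suc (l + k)) (value t)      ≡⟨ cong (λ m → θ^ m (value t)) (+-suc l k) ⟨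
          θ^ (l + suc k) (value t)        ≡⟨ θ^-+ l (suc k) (value t) ⟩
          θ^ l (θ^ (suc k) (value t))     ≡⟨ cong (θ^ l) eq ⟩
          θ^ l (value s)                  ≡⟨ eq′ ⟩
          value t                         ∎)
          where open ≡-Reasoning

        s-cyclic : Cyclic (value s)
        s-cyclic = subst Cyclic eq (cyclic-θ^ (suc k) t-cyclic)

      module _ (σ : partialAlgebra c ≅ᵖ partialAlgebra c) where
        open _≅ᵖ_ σ

        σ-injective : ∀ {s t} → to s ≡ to t → s ≡ t
        σ-injective = Bijection.injective bijection

        -- If `t` is the root, so is any `s` below it. Otherwise `θ` stays in the tree at `t`.
        dom : ∀ {s t k} → s ≢ t → θ^ k (value t) ≡ value s → InTree c (θ (value t))
        dom {s} {t} {k} s≢t eq with inTree-θ (inTree t)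
        ... | inj₂ d     = d
        ... | inj₁ t≡c = contradiction (trans (≼-root s (k , trans (cong (θ^ k) (sym t≡c)) eq))
                                              (Tree-≡ (sym t≡c))) s≢t

        to-≼ : ∀ k {s t} → θ^ k (value t) ≡ value s → to s ≼ to t
        to-≼ zero eq = 0 , cong (value ∘ to) (Tree-≡ eq)
        to-≼ (suc k) {s} {t} eq with em {s ≡ t}
        -- Here the path runs around the cycle, possibly outside the tree, so it is replaced by the
        -- empty path.
        ... | yes refl = 0 , refl
        ... | no  s≢t  = suc (proj₁ ih) , trans (sym (θ^-suc (proj₁ ih) _))
          (trans (cong (θ^ (proj₁ ih)) (sym (cong value (preserves-θ t d d′)))) (proj₂ ih))
          where
          d : InTree c (θ (value t))
          d = dom {s} {t} {suc k} s≢t eq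

          d′ : InTree c (θ (value (to t)))
          d′ = Equivalence.to (preserves-Dom t) d

          ih : to s ≼ to (θ (value t) , [ d ])
          ih = to-≼ k (trans (θ^-suc k (value t)) eq)

        to-≼⁻ : ∀ k {s t} → θ^ k (value (to t)) ≡ value (to s) → s ≼ t
        to-≼⁻ zero eq = 0 , sym (cong value (σ-injective (Tree-≡ (sym eq))))
        to-≼⁻ (suc k) {s} {t} eq with em {s ≡ t}
        ... | yes refl = 0 , refl
        ... | no  s≢t  = suc (proj₁ ih) , trans (sym (θ^-suc (proj₁ ih) _)) (proj₂ ih)
          where
          d′ : InTree c (θ (value (to t)))
          d′ = dom {to s} {to t} {suc k} (s≢t ∘ σ-injective) eq

          d : InTree c (θ (value t))
          d = Equivalence.from (preserves-Dom t) d′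

          ih : s ≼ (θ (value t) , [ d ])
          ih = to-≼⁻ k (trans (cong (θ^ k ∘ value) (preserves-θ t d d′)) (trans (θ^-suc k _) eq))

        order-≅ : order c ≅ order c
        order-≅ = record
          { bijection     = bijection
          ; preserves-op  = λ ()
          ; preserves-rel = λ { ≤̇ (s ∷ t ∷ []) → mk⇔ (λ (k , eq) → to-≼ k eq) (λ (k , eq) → to-≼⁻ k eq) }
          }

      order-ωCategorical : Countable Carrier → ωCategoricalᵖ (partialAlgebra c) → ωCategorical (order c)
      order-ωCategorical countable ωcat =
        Oligomorphic⇒ωCategorical (order c) (tree-countable countable c) oligo
        where
        oligo : Oligomorphic (order c)
        oligo zero    = [] ∷ [] , λ { [] → here orbit-refl }
        oligo (suc n) with ωcat (suc n) (s≤s z≤n)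
        ... | tss , covers = tss , λ ts → Any.map (λ (σ , eq) → order-≅ σ , eq) (covers ts)

      opaque
        order-orbits : Countable Carrier → ωCategorical (order c) → FinitelyManyUpTo (SameOrbit (order c))
        order-orbits countable ωcat
          with ωCategorical⇒Oligomorphic finite (order c) (root c) (tree-countable countable c) ωcat 1
          where
          finite : FiniteLanguage orderLanguage
          finite = record { ops = [] ; rels = (2 , ≤̇) ∷ [] ; ∈ops = λ () ; ∈rels = λ { ≤̇ → here refl } }
        ... | ρs , covers = List.map Vec.head ρs , λ t →
          Any.map⁺ (Any.map (λ { {s ∷ []} (σ , eq) → σ , Vec.∷-injectiveˡ eq }) (covers (t ∷ [])))

      module _ (σ : order c ≅ order c) where
        open _≅_ σ

        mono : ∀ {s t} → s ≼ t → to s ≼ to t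
        mono {s} {t} = Equivalence.to (preserves-rel ≤̇ (s ∷ t ∷ []))

        mono⁻ : ∀ {s t} → to s ≼ to t → s ≼ t
        mono⁻ {s} {t} = Equivalence.from (preserves-rel ≤̇ (s ∷ t ∷ []))

        to-root : to (root c) ≡ root c
        to-root = ≼-root (to (root c))
          (subst (to (root c) ≼_) (to∘to⁻¹ σ (root c)) (mono (root-≼ (to⁻¹ σ (root c)))))

        -- The root is the only cyclic vertex of the tree, and it is fixed because it is the least
        -- element.
        order-cyclic : ∀ t → Cyclic (value (to t)) → Cyclic (value t)
        order-cyclic t cyc = subst (Cyclic ∘ value)
          (sym (to-injective σ (trans (cyclic⇒root (to t) cyc) (sym to-root)))) c-cyclic

        -- The order determines θ: θ t is the only element covered by t.
        to-up : ∀ t (¬c : ¬ Cyclic (value t)) → value (to (up t ¬c)) ≡ θ (value (to t))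
        to-up t ¬c with mono {up t ¬c} {t} (1 , refl)
        ... | zero , eq = contradiction (0 , cong value (to-injective σ {up t ¬c} {t} (Tree-≡ (sym eq)))) ¬c
        -- Both `up t ¬c` and the preimage `w` of `u` are the greatest element strictly below `t`.
        ... | suc k , eq = trans (cong (value ∘ to) (≼-antisym up≼w w≼up)) (cong value (to∘to⁻¹ σ u))
          where
          ¬c′ : ¬ Cyclic (value (to t))
          ¬c′ = ¬c ∘ order-cyclic t

          u : Tree c
          u = up (to t) ¬c′

          w : Tree c
          w = to⁻¹ σ u

          up≼w : up t ¬c ≼ w
          up≼w = mono⁻ (subst (to (up t ¬c) ≼_) (sym (to∘to⁻¹ σ u)) (k , trans (θ^-suc k _) eq))

          w≼up : w ≼ up t ¬c
          w≼up with mono⁻ {w} {t} (subst (_≼ to t) (sym (to∘to⁻¹ σ u)) (1 , refl))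
          ... | suc j , eq′ = j , trans (θ^-suc j _) eq′
          ... | zero  , eq′ = contradiction (0 , cong value
            (trans (sym (to∘to⁻¹ σ u)) (cong to (sym (Tree-≡ {s = t} {w} eq′))))) ¬c′

        order-height : ∀ n t → Cyclic (θ^ n (value (to t))) → Cyclic (θ^ n (value t))
        order-height zero    t cyc = order-cyclic t cyc
        order-height (suc n) t cyc with em {Cyclic (value t)}
        ... | yes c = cyclic-θ^ (suc n) c
        ... | no ¬c = subst Cyclic (θ^-suc n _) (order-height n (up t ¬c)
          (subst Cyclic (trans (sym (θ^-suc n _)) (cong (θ^ n) (sym (to-up t ¬c)))) cyc))

    -- Conditions sufficient for ω-categoricity

    module Sufficient (countable : Countable Carrier) (connected : Connected) where

      module _ (locallyFinite : LocallyFinite) (orbits : FinitelyManyUpTo (SameOrbit structure)) where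

        locallyFinite⇒cyclic : ∀ x → ∃[ n ] Cyclic (θ^ n x)
        locallyFinite⇒cyclic x
          with infinite-pigeonhole (λ n → proj₂ (locallyFinite x []) (θ^ n x) (power n))
          where
          power : ∀ n → Generated (x ∷ []) (θ^ n x)
          power zero    = gen (here refl)
          power (suc n) = step (power n)
        ... | i , j , i<j , _ , p , q = i , periodic⇒cyclic i<j (trans p (sym q))

        orbits⇒ωCategorical : ωCategorical structure
        orbits⇒ωCategorical = Oligomorphic⇒ωCategorical structure countable
          (Core.oligomorphic countable connected (proj₂ (locallyFinite⇒cyclic inhabited))
            (proj₁ height) (proj₂ height) (SameOrbit structure)
            (λ { (σ , refl) → ≅-sym σ , to⁻¹∘to σ _ })
            (λ { (σ , refl) → _≅_.to σ ,
              (λ { (refl , ¬c) → (sym (to-θ σ _) , λ c → ¬c (to-cyclic⁻ σ c)) , σ , refl }) ,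
              λ _ _ → to-injective σ })
            orbits)
          where
          height : ∃[ h ] (∀ x → Cyclic (θ^ h x))
          height = bounded-height orbits locallyFinite⇒cyclic
            λ { n (σ , refl) c → to-cyclic⁻ σ (subst Cyclic (sym (to-θ^ σ n _)) c) }

      module _ {c₀ : Carrier} (c₀-cyclic : Cyclic c₀)
               (ωcat : ∀ c → Cyclic c → ωCategorical (order c)) where
        open Cycle connected c₀-cyclic

        -- Conjugacy under the automorphisms of one of the orders, phrased for elements of the
        -- algebra so that all the trees are covered by a single relation.
        Similar : Carrier → Carrier → Set
        Similar x y = ∃[ c ] Cyclic c × Σ[ s ∈ Tree c ] Σ[ t ∈ Tree c ]
          value s ≡ x × value t ≡ y × SameOrbit (order c) s t

        similar-sym : ∀ {x y} → Similar x y → Similar y x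
        similar-sym (c , cyc , s , t , eq , eq′ , σ , refl) =
          c , cyc , t , s , eq′ , eq , ≅-sym σ , to⁻¹∘to σ s

        -- By `to-up`, automorphisms of the order commute with `θ` at acyclic vertices, so they take
        -- children to children.
        similar-children : ∀ {v z} → Similar v z → Embeds Similar v z
        similar-children (c , cyc , s , t , refl , refl , σ , refl) =
          embeds-by {Similar} to (to-injective σ) (λ t → c , cyc , t , to t , refl , refl , σ , refl) s
            λ t (θt≡s , ¬c) → trans (sym (to-up σ t ¬c)) (cong (value ∘ to) (Tree-≡ θt≡s)) ,
                              ¬c ∘ order-cyclic σ t
          where
          open Order cyc
          open _≅_ σ using (to)

        -- The root is the first cyclic element on the path from `x`.
        tree-of : ∀ x → ∃[ c ] Cyclic c × InTree c x
        tree-of x with least (eventually-cyclic x)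
        ... | zero  , cyc , _     = x , cyc , inj₁ refl
        ... | suc n , cyc , least = θ^ (suc n) x , cyc , inj₂
          ((λ c → contradiction (least 0 c) λ ()) , n , refl , λ c → <-irrefl refl (least n c))

        similar-finite : FinitelyManyUpTo Similar
        similar-finite = List.concatMap representatives cycle , λ x →
          let (c , cyc , p) = tree-of x in
          Any.concat⁺ (Any.map⁺ (lose (cyclic⇒∈cycle cyc) (covers c cyc (x , [ p ]))))
          where
          representatives : Carrier → List Carrier
          representatives c with em {Cyclic c}
          ... | yes cyc = List.map value (proj₁ (Order.order-orbits cyc countable (ωcat c cyc)))
          ... | no  _   = []

          covers : ∀ c → Cyclic c → (t : Tree c) → Any (Similar (value t)) (representatives c)
          covers c cyc t with em {Cyclic c}
          ... | no ¬cyc = contradiction cyc ¬cyc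
          ... | yes cyc = Any.map⁺ (Any.map (λ {s} orbit → c , cyc , t , s , refl , refl , orbit)
            (proj₂ (Order.order-orbits cyc countable (ωcat c cyc)) t))

        orders⇒ωCategorical : ωCategorical structure
        orders⇒ωCategorical = Oligomorphic⇒ωCategorical structure countable
          (Core.oligomorphic countable connected c₀-cyclic (proj₁ height) (proj₂ height)
            Similar similar-sym similar-children similar-finite)
          where
          height : ∃[ h ] (∀ x → Cyclic (θ^ h x))
          height = bounded-height similar-finite eventually-cyclic
            λ { n (c , cyc , s , t , refl , refl , σ , refl) → Order.order-height cyc σ n s }

      -- Besides the roots of isomorphic trees, this relates all vertices that correspond under an
      -- isomorphism, so that the same isomorphism embeds their children again.
      Matched : Carrier → Carrier → Set
      Matched x y = ∃₂ λ u v → Σ[ φ ∈ partialAlgebra u ≅ᵖ partialAlgebra v ]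
        Σ[ s ∈ Tree u ] value s ≡ x × value (_≅ᵖ_.to φ s) ≡ y

      matched-sym : ∀ {x y} → Matched x y → Matched y x
      matched-sym (u , v , φ , s , refl , refl) = v , u , ≅ᵖ-sym φ , to s , refl ,
        cong value (Bijection.injective bijection (proj₂ (Bijection.surjective bijection (to s)) refl))
        where open _≅ᵖ_ φ

      matched-children : ∀ {v z} → Matched v z → Embeds Matched v z
      matched-children (u , v , σ , s , refl , refl) =
        embeds-by {Matched} to (Bijection.injective bijection) (λ t → u , v , σ , t , refl , refl) s to-child
        where
        open _≅ᵖ_ σ

        to-child : ∀ t → Child (value s) (value t) → Child (value (to s)) (value (to t))
        to-child t (θt≡s , ¬c) =
          trans (sym (cong value to-θt)) (cong (value ∘ to) (Tree-≡ θt≡s)) ,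
          -- If the image of `t` were cyclic, both it and its value under `θ` would be the root `v`,
          -- and then `t` would be a fixed point of `θ`.
          λ c → ¬c (0 , cong value (Bijection.injective bijection (trans to-θt (Tree-≡
            (trans (inTree-cyclic d′ (cyclic-θ^ 1 c)) (sym (inTree-cyclic (inTree (to t)) c)))))))
          where
          d : InTree u (θ (value t))
          d = subst (InTree u) (sym θt≡s) (inTree s)

          d′ : InTree v (θ (value (to t)))
          d′ = Equivalence.to (preserves-Dom t) d

          to-θt : to (θ (value t) , [ d ]) ≡ (θ (value (to t)) , [ d′ ])
          to-θt = preserves-θ t d d′

      trees⇒ωCategorical : HasFiniteHeight →
        FinitelyManyUpTo (λ x y → partialAlgebra x ≅ᵖ partialAlgebra y) → ωCategorical structure
      trees⇒ωCategorical (h , bounded , _) (xs , covers) = Oligomorphic⇒ωCategorical structure countable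
        (Core.oligomorphic countable connected (cyclic-h inhabited) h cyclic-h
          Matched matched-sym matched-children
          (xs , λ x → Any.map (λ {y} φ → x , y , φ , root x , refl , to-root-≅ᵖ φ) (covers x)))
        where
        cyclic-h : ∀ x → Cyclic (θ^ h x)
        cyclic-h x = let (m , (c , _) , m≤h) = bounded x in cyclic-≤ m≤h c

theorem5p9 : ExcludedMiddle 0ℓ →
    (𝒜 : MonounaryAlgebra) → let open MonounaryAlgebra 𝒜 in
    Countable Carrier → Connected →
    (ωCategorical structure ⇔ (∃ Cyclic × (∀ c → Cyclic c → ωCategoricalᵖ (partialAlgebra c))))
    × (ωCategorical structure ⇔ (∃ Cyclic × (∀ c → Cyclic c → ωCategorical (order c))))
    × (ωCategorical structure ⇔ (HasFiniteHeight × FinitelyManyUpTo (λ x y → partialAlgebra x ≅ᵖ partialAlgebra y)))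
    × (ωCategorical structure ⇔ (LocallyFinite × FinitelyManyUpTo (SameOrbit structure)))
theorem5p9 em 𝒜 countable connected =
    mk⇔ (λ 1ᶜ → hasCyclic 1ᶜ , λ c _ → partialAlgebra-ωCategorical 1ᶜ c)
        -- The partial algebras are handled through the orders, which are invariant under their
        -- automorphisms.
        (λ ((c , cyc) , 2ᶜ) → orders⇒ωCategorical cyc (λ c cyc → order-ωCategorical cyc countable (2ᶜ c cyc)))
  , mk⇔ (λ 1ᶜ → hasCyclic 1ᶜ , λ c cyc →
            order-ωCategorical cyc countable (partialAlgebra-ωCategorical 1ᶜ c))
        (λ ((c , cyc) , 3ᶜ) → orders⇒ωCategorical cyc 3ᶜ)
  , mk⇔ (λ 1ᶜ → finiteHeight 1ᶜ , finitelyManyTrees 1ᶜ)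
        (λ (height , trees) → trees⇒ωCategorical height trees)
  , mk⇔ (λ 1ᶜ → locallyFinite 1ᶜ , finitelyManyOrbits 1ᶜ)
        (λ (finite , orbits) → orbits⇒ωCategorical finite orbits)
  where
  open Classical em
  open Unary 𝒜
  open Consequences countable connected
  open Sufficient countable connected
  open Order using (order-ωCategorical)
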